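{- For every integer $n\geq 8$, we have $D(n,K^\circlearrowright_3)=2^{\lfloor n^2/4\rfloor}$. Furthermore, among all graphs $G$ with $n$ vertices ($n\ge 8$), $D(G,K^\circlearrowright_3)=2^{\lfloor n^2/4\rfloor}$ if and only if $G\simeq K_{\lfloor n/2\rfloor,\lceil n/2\rceil}$.
   Context: All graphs are finite and simple. An orientation of a graph $G$ assigns a direction to each edge. $K^\circlearrowright_3$ denotes the directed (cyclically oriented, strongly connected) triangle. For a graph $G$, $D(G,K^\circlearrowright_3)$ is the number of orientations of $G$ containing no copy of $K^\circlearrowright_3$ (equivalently, in which every triangle of $G$ is transitively oriented). $D(n,K^\circlearrowright_3)=\max\{D(G,K^\circlearrowright_3)\colon G \text{ an $n$-vertex graph}\}$. -}

module Defs where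

open import Data.Bool using (Bool; true; false; _∧_; _∨_; not; if_then_else_; T)
open import Data.Nat using (ℕ; zero; suc; _*_; _/_; _<ᵇ_)
open import Data.Fin using (Fin; toℕ)
open import Data.Fin.Properties using (_≟_)
open import Data.Fin.Permutation using (Permutation′; _⟨$⟩ʳ_)
open import Data.List using (List; []; _∷_; map; concatMap; length; filterᵇ)
open import Data.Bool.ListAction using (all; any)
open import Data.List using (allFin)
open import Data.Product using (Σ)
open import Relation.Binary.PropositionalEquality using (_≡_)
open import Relation.Nullary.Decidable using (⌊_⌋)

record Graph (n : ℕ) : Set where
  field
    adj     : Fin n → Fin n → Bool
    adj-sym : ∀ i j → adj i j ≡ adj j i
    adj-irr : ∀ i → adj i i ≡ false
open Graph public

_≺_ : {n : ℕ} → Fin n → Fin n → Bool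
i ≺ j = toℕ i <ᵇ toℕ j

allFns : {B : Set} (k : ℕ) → List B → List (Fin k → B)
allFns zero    bs = (λ ()) ∷ []
allFns (suc k) bs =
  concatMap (λ b → map (λ f → λ { Fin.zero → b ; (Fin.suc i) → f i }) (allFns k bs)) bs

-- An orientation of G is encoded by σ : Fin n → Fin n → Bool, where for
-- every edge {i,j} with i ≺ j, σ i j = true means i → j and σ i j = false
-- means j → i.  To obtain exactly one code per orientation, σ is required
-- to be false at all pairs (i,j) that are not edges with i ≺ j.
Code : ℕ → Set
Code n = Fin n → Fin n → Bool

allCodes : (n : ℕ) → List (Code n)
allCodes n = allFns n (allFns n (true ∷ false ∷ []))

module _ {n : ℕ} (G : Graph n) where

  normalised : Code n → Bool
  normalised σ = all (λ i → all (λ j →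
      not (σ i j) ∨ (adj G i j ∧ (i ≺ j))) (allFin n)) (allFin n)

  arc : Code n → Fin n → Fin n → Bool
  arc σ i j = adj G i j ∧ (if i ≺ j then σ i j else not (σ j i))

  hasCyclicTriangle : Code n → Bool
  hasCyclicTriangle σ = any (λ a → any (λ b → any (λ c →
      arc σ a b ∧ arc σ b c ∧ arc σ c a) (allFin n)) (allFin n)) (allFin n)

  D : ℕ
  D = length (filterᵇ (λ σ → normalised σ ∧ not (hasCyclicTriangle σ)) (allCodes n))

Kbip : (n : ℕ) → Graph n
Kbip n = record
  { adj = λ i j → inL i xor inL j
  ; adj-sym = λ i j → xor-comm (inL i) (inL j)
  ; adj-irr = λ i → xor-self (inL i) }
  where
    inL : Fin n → Bool
    inL i = toℕ i <ᵇ (n / 2)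
    _xor_ : Bool → Bool → Bool
    true  xor b = not b
    false xor b = b
    xor-comm : ∀ a b → (a xor b) ≡ (b xor a)
    xor-comm true true = Relation.Binary.PropositionalEquality.refl
    xor-comm true false = Relation.Binary.PropositionalEquality.refl
    xor-comm false true = Relation.Binary.PropositionalEquality.refl
    xor-comm false false = Relation.Binary.PropositionalEquality.refl
    xor-self : ∀ a → (a xor a) ≡ false
    xor-self true = Relation.Binary.PropositionalEquality.refl
    xor-self false = Relation.Binary.PropositionalEquality.refl

_≃G_ : {n : ℕ} → Graph n → Graph n → Set
_≃G_ {n} G H = Σ (Permutation′ n) λ π →
  ∀ i j → adj G (π ⟨$⟩ʳ i) (π ⟨$⟩ʳ j) ≡ adj H i j

{-# OPTIONS --safe #-}
module Submission where

-- Deleting a vertex v shows D(G) ≤ u · D(G - v), where u bounds the number of ways to orient the edges at v: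
-- the out-neighbourhood of v must be closed under the arcs inside N(v).  If N(v) spans a graph on d vertices
-- of minimum degree m, then there are at most (m + 2) / 2^(m+1) · 2^d closed sets, and slightly better bounds
-- hold for m ≤ 3 and d large.  Take v of minimum degree ⌊n/2⌋ + k.  If k ≤ 0 then 2^d is at most the growth
-- 2^⌊n/2⌋ of the claimed maximum; if k > 0 then N(v) has minimum degree at least 2k or 2k - 1 and the bounds
-- on closed sets win.  Two points need care.  For odd n and k ∈ {1, 2} the factor can exceed 2^⌊n/2⌋ by 17/16,
-- which is absorbed by a gap: for even n every graph other than the balanced complete bipartite one has
-- D < 16/17 · 2^(n²/4).  And the induction starts from D(G) ≤ n! for n ≤ 7, which is not implied by the
-- general bounds; the remaining finitely many graphs are handled by a verified search.

open import Defs
open import Data.Bool using (Bool; true; false; _∧_; _∨_; not; if_then_else_; T)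
open import Data.Bool.ListAction using (all; any)
open import Data.Bool.Properties using (T-≡; T?; ∧-zeroʳ; ∧-identityʳ; ∨-zeroʳ; not-involutive)
open import Data.Empty using (⊥-elim)
open import Data.Fin as Fin using (Fin; zero; suc; toℕ; fromℕ<; punchIn; punchOut)
open import Data.Fin.Permutation as Perm using (Permutation′; _⟨$⟩ʳ_; _⟨$⟩ˡ_)
import Data.Fin.Properties as Fin
open import Data.Fin.Properties using (any?)
open import Data.List as List using (List; []; _∷_; length; _++_; filterᵇ; allFin; tabulate; concatMap)
open import Data.List.Membership.Propositional using (find; lose) renaming (_∈_ to _∈ˡ_)
open import Data.List.Membership.Propositional.Properties
  using (∈-map⁺; ∈-++⁺ˡ; ∈-++⁺ʳ; ∈-filter⁺; ∈-filter⁻; ∈-allFin; ∈-lookup)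
open import Data.List.Properties using (length-map; length-++; length-tabulate)
open import Data.List.Relation.Unary.All as All using (All; []; _∷_)
import Data.List.Relation.Unary.All.Properties as All
open import Data.List.Relation.Unary.AllPairs as AllPairs using (AllPairs; []; _∷_)
import Data.List.Relation.Unary.AllPairs.Properties as AllPairs
open import Data.List.Relation.Unary.Any as Any using (Any; here; there)
import Data.List.Relation.Unary.Any.Properties as Any
open import Data.Nat
open import Data.Nat.Divisibility using (divides-refl)
open import Data.Nat.DivMod using (m*n/n≡m; m/n≤m; +-distrib-/-∣ʳ)
open import Data.Nat.Properties
open import Algebra.Properties.CommutativeMonoid.Sum +-0-commutativeMonoid
  using (sum; sum-permute; ∑-comm; ∑-distrib-+; sum-cong-≗)
open import Data.Nat.Tactic.RingSolver using (solve-∀)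
open import Data.Product using (Σ; ∃; ∃₂; _×_; _,_; proj₁; proj₂)
open import Data.Sum as Sum using (_⊎_; inj₁; inj₂; [_,_]′)
open import Data.Unit using (tt)
open import Data.Vec as Vec using (Vec; []; _∷_)
import Data.Vec.Properties as Vec
open import Function using (_∘_; id)
open import Function.Bundles using (Equivalence; _⇔_; mk⇔)
open import Relation.Binary.Definitions using (Tri; tri<; tri≈; tri>)
open import Relation.Binary.PropositionalEquality
open import Relation.Nullary
open import Relation.Nullary.Decidable using (dec-true)

-- Subsets of Fin n

-- The bound 8 is where the complete graph stops winning. It has n! admissible orientations, and n!
-- exceeds 2^⌊n²/4⌋ for 3 ≤ n ≤ 7 (5040 against 4096 at n = 7) but no longer at n = 8. So the
-- induction cannot start from the formula that it proves: it starts with the surplus 5040/4096,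
-- which the step to n = 8 has to absorb.
--
-- For n = 2h the maximum should grow by 2^h, and every outcome of the step other than the complete
-- bipartite graph costs a factor 3/4. At n = 8 this leaves 7! · 12 = 60480, just below 16/17 ·
-- 2^16, and from n = 10 on 3/4 itself is below 16/17. The 17 stems from the bounds 17/32 and 17/64
-- on closed sets that odd n calls for.
--
-- The induction runs over vertex sets `S` of one fixed graph, so no induced subgraphs are built.
-- Upper bounds are covering lists rather than exact counts; `D` is evaluated exactly only for
-- balanced complete bipartite graphs, which gives both attainment and one direction of the
-- equivalence.

bit : Bool → ℕ
bit b = if b then 1 else 0

count : ∀ {n} → (Fin n → Bool) → ℕ
count {zero}  P = 0
count {suc n} P = bit (P zero) + count (P ∘ suc)

infix 4 _∈_ _∉_
infixl 6 _∩_ _∖_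

-- A record instead of the bare equation, so that unification can recover `x` and `P` from the type
-- of a membership proof.
record _∈_ {n} (x : Fin n) (P : Fin n → Bool) : Set where
  constructor mem
  field holds : P x ≡ true
open _∈_ public

_∉_ : ∀ {n} → Fin n → (Fin n → Bool) → Set
x ∉ P = ¬ x ∈ P

_∈?_ : ∀ {n} (x : Fin n) (P : Fin n → Bool) → Dec (x ∈ P)
x ∈? P with P x in eq
... | true  = yes (mem eq)
... | false = no λ { (mem e) → false≢true (trans (sym eq) e) }
  where
  false≢true : false ≢ true
  false≢true ()

∉⇒false : ∀ {n} {x : Fin n} {P} → x ∉ P → P x ≡ false
∉⇒false {x = x} {P} x∉P with P x in eq
... | true  = ⊥-elim (x∉P (mem eq))
... | false = refl

false⇒∉ : ∀ {n} {x : Fin n} {P} → P x ≡ false → x ∉ P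
false⇒∉ e (mem e′) with () ← trans (sym e) e′

_⊆_ : ∀ {n} → (Fin n → Bool) → (Fin n → Bool) → Set
P ⊆ Q = ∀ {x} → x ∈ P → x ∈ Q

abstract
  card : ∀ {n} → (Fin n → Bool) → ℕ
  card = count

  card≡count : ∀ {n} (P : Fin n → Bool) → card P ≡ count P
  card≡count P = refl

  _∩_ _∖_ : ∀ {n} → (Fin n → Bool) → (Fin n → Bool) → (Fin n → Bool)
  (P ∩ Q) x = P x ∧ Q x
  (P ∖ Q) x = P x ∧ not (Q x)

  ⁅_⁆ : ∀ {n} → Fin n → (Fin n → Bool)
  ⁅ x ⁆ y = does (y Fin.≟ x)

  ∈∩ : ∀ {n} {P Q : Fin n → Bool} {x} → x ∈ P → x ∈ Q → x ∈ P ∩ Q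
  ∈∩ {Q = Q} {x} (mem p) (mem q) = mem (trans (cong (_∧ Q x) p) q)

  ∩ˡ : ∀ {n} {P Q : Fin n → Bool} {x} → x ∈ P ∩ Q → x ∈ P
  ∩ˡ {P = P} {x = x} (mem e) with P x in p
  ... | true = mem p

  ∩ʳ : ∀ {n} {P Q : Fin n → Bool} {x} → x ∈ P ∩ Q → x ∈ Q
  ∩ʳ {P = P} {x = x} (mem e) with P x
  ... | true = mem e

  ∈∖ : ∀ {n} {P Q : Fin n → Bool} {x} → x ∈ P → x ∉ Q → x ∈ P ∖ Q
  ∈∖ {Q = Q} {x} (mem p) q = mem (trans (cong (_∧ not (Q x)) p) (cong not (∉⇒false {P = Q} q)))

  ∖ˡ : ∀ {n} {P Q : Fin n → Bool} {x} → x ∈ P ∖ Q → x ∈ P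
  ∖ˡ {P = P} {x = x} (mem e) with P x in p
  ... | true = mem p

  ∖ʳ : ∀ {n} {P Q : Fin n → Bool} {x} → x ∈ P ∖ Q → x ∉ Q
  ∖ʳ {P = P} {x = x} (mem e) (mem q) rewrite q with P x
  ∖ʳ {P = P} {x = x} (mem ()) (mem q) | true
  ∖ʳ {P = P} {x = x} (mem ()) (mem q) | false

  ∈⁅⁆ : ∀ {n} (x : Fin n) → x ∈ ⁅ x ⁆
  ∈⁅⁆ x = mem (dec-true (x Fin.≟ x) refl)

  ⁅⁆⇒≡ : ∀ {n} {x y : Fin n} → y ∈ ⁅ x ⁆ → y ≡ x
  ⁅⁆⇒≡ {x = x} {y} (mem e) with y Fin.≟ x
  ... | yes p = p

  card-split : ∀ {n} (P Q : Fin n → Bool) → card P ≡ card (P ∩ Q) + card (P ∖ Q)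
  card-split {zero}  P Q = refl
  card-split {suc n} P Q = begin
    bit (P zero) + card (P ∘ suc)
      ≡⟨ cong₂ _+_ (bit-split (P zero) (Q zero)) (card-split (P ∘ suc) (Q ∘ suc)) ⟩
    (b₁ + b₂) + (c₁ + c₂)
      ≡⟨ +-assoc b₁ b₂ _ ⟩
    b₁ + (b₂ + (c₁ + c₂))
      ≡⟨ cong (b₁ +_) (trans (sym (+-assoc b₂ c₁ c₂)) (trans (cong (_+ c₂) (+-comm b₂ c₁)) (+-assoc c₁ b₂ c₂))) ⟩
    b₁ + (c₁ + (b₂ + c₂))
      ≡⟨ +-assoc b₁ c₁ _ ⟨
    (b₁ + c₁) + (b₂ + c₂) ∎
    where
    open ≡-Reasoning
    b₁ b₂ c₁ c₂ : ℕ
    b₁ = bit (P zero ∧ Q zero)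
    b₂ = bit (P zero ∧ not (Q zero))
    c₁ = card ((P ∘ suc) ∩ (Q ∘ suc))
    c₂ = card ((P ∘ suc) ∖ (Q ∘ suc))
    bit-split : ∀ p q → bit p ≡ bit (p ∧ q) + bit (p ∧ not q)
    bit-split true  true  = refl
    bit-split true  false = refl
    bit-split false q     = refl

  card-mono : ∀ {n} {P Q : Fin n → Bool} → P ⊆ Q → card P ≤ card Q
  card-mono {zero}          P⊆Q = z≤n
  card-mono {suc n} {P} {Q} P⊆Q = +-mono-≤ bits (card-mono {P = P ∘ suc} {Q ∘ suc} λ { (mem p) → mem (holds (P⊆Q (mem p))) })
    where
    bits : bit (P zero) ≤ bit (Q zero)
    bits with P zero in p
    ... | false = z≤n
    ... | true rewrite holds (P⊆Q (mem p)) = ≤-refl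

  card-∅ : ∀ {n} → card {n} (λ _ → false) ≡ 0
  card-∅ {zero}  = refl
  card-∅ {suc n} = card-∅ {n}

  card-full : ∀ {n} → card {n} (λ _ → true) ≡ n
  card-full {zero}  = refl
  card-full {suc n} = cong suc (card-full {n})

  member⇒card>0 : ∀ {n} {P : Fin n → Bool} {x} → x ∈ P → 1 ≤ card P
  member⇒card>0 {P = P} {zero}  (mem p) rewrite p = s≤s z≤n
  member⇒card>0 {P = P} {suc x} (mem p) = ≤-trans (member⇒card>0 {P = P ∘ suc} {x} (mem p)) (m≤n+m _ (bit (P zero)))

  card>0⇒member : ∀ {n} {P : Fin n → Bool} → 1 ≤ card P → ∃ (_∈ P)
  card>0⇒member {suc n} {P} c with P zero in p
  ... | true  = zero , mem p
  ... | false with x , mem q ← card>0⇒member {P = P ∘ suc} c = suc x , mem q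

  card-suc : ∀ {n} (P : Fin (suc n) → Bool) → card P ≡ bit (P zero) + card (P ∘ suc)
  card-suc P = refl

card-cong : ∀ {n} {P Q : Fin n → Bool} → P ⊆ Q → Q ⊆ P → card P ≡ card Q
card-cong P⊆Q Q⊆P = ≤-antisym (card-mono P⊆Q) (card-mono Q⊆P)

card-empty : ∀ {n} {P : Fin n → Bool} → (∀ {x} → x ∉ P) → card P ≡ 0
card-empty {n} {P} e = trans (card-cong {P = P} {λ _ → false} (λ p → ⊥-elim (e p)) λ { (mem ()) }) (card-∅ {n})

module _ {n} {P Q R : Fin n → Bool} where
  card-cover : (∀ {x} → x ∈ P → x ∈ Q ⊎ x ∈ R) → card P ≤ card Q + card R
  card-cover cov rewrite card-split P Q =
    +-mono-≤ (card-mono {P = P ∩ Q} ∩ʳ) (card-mono λ p → [ (λ q → ⊥-elim (∖ʳ p q)) , id ]′ (cov (∖ˡ p)))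

  card-disjoint : Q ⊆ P → R ⊆ P → (∀ {x} → x ∈ Q → x ∉ R) → card Q + card R ≤ card P
  card-disjoint Q⊆P R⊆P dis rewrite card-split P Q =
    +-mono-≤ (card-mono λ q → ∈∩ (Q⊆P q) q) (card-mono λ r → ∈∖ (R⊆P r) (λ q → dis q r))

⊆-card-≥⇒⊇ : ∀ {n} {P Q : Fin n → Bool} → P ⊆ Q → card Q ≤ card P → Q ⊆ P
⊆-card-≥⇒⊇ {P = P} {Q} P⊆Q le {x} q with x ∈? P
... | yes p  = p
... | no x∉P = ⊥-elim (<⇒≱ (<-≤-trans (m<n+m (card P) (member⇒card>0 (∈∖ q x∉P))) bound) le)
  where
  bound : card (Q ∖ P) + card P ≤ card Q
  bound = card-disjoint ∖ˡ P⊆Q ∖ʳ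

card-⁅⁆ : ∀ {n} (x : Fin n) → card ⁅ x ⁆ ≡ 1
card-⁅⁆ {suc n} zero = begin
  card (⁅_⁆ {suc n} zero)  ≡⟨ card-suc (⁅_⁆ {suc n} zero) ⟩
  bit (⁅_⁆ {suc n} zero zero) + card (⁅_⁆ {suc n} zero ∘ suc)  
    ≡⟨ cong₂ (λ b c → bit b + c) (holds (∈⁅⁆ {suc n} zero))
      (card-empty {n} {P = ⁅ zero {n} ⁆ ∘ suc} λ { (mem p) → Fin.0≢1+n (sym (⁅⁆⇒≡ (mem p))) }) ⟩
  1 ∎
  where open ≡-Reasoning
card-⁅⁆ {suc n} (suc x) = begin
  card ⁅ suc x ⁆  ≡⟨ card-suc ⁅ suc x ⁆ ⟩
  bit (⁅ suc x ⁆ zero) + card (⁅ suc x ⁆ ∘ suc)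
    ≡⟨ cong₂ (λ b c → bit b + c)
         (∉⇒false {P = ⁅ suc x ⁆} λ p → Fin.0≢1+n (⁅⁆⇒≡ p))
         (card-cong {P = ⁅ suc x ⁆ ∘ suc} {⁅ x ⁆}
           (λ { (mem p) → subst (_∈ ⁅ x ⁆) (sym (Fin.suc-injective (⁅⁆⇒≡ (mem p)))) (∈⁅⁆ x) })
           (λ p → mem (holds (subst (λ y → suc y ∈ ⁅ suc x ⁆) (sym (⁅⁆⇒≡ p)) (∈⁅⁆ (suc x)))))) ⟩
  card ⁅ x ⁆
    ≡⟨ card-⁅⁆ x ⟩
  1 ∎
  where open ≡-Reasoning

card-remove : ∀ {n} {P : Fin n → Bool} {x} → x ∈ P → card P ≡ suc (card (P ∖ ⁅ x ⁆))
card-remove {P = P} {x} p = trans (card-split P ⁅ x ⁆) (cong (_+ card (P ∖ ⁅ x ⁆))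
  (trans (card-cong ∩ʳ (λ q → ∈∩ (subst (_∈ P) (sym (⁅⁆⇒≡ q)) p) q)) (card-⁅⁆ x)))

two-members : ∀ {n} {P : Fin n → Bool} {x y} → x ∈ P → y ∈ P → x ≢ y → 2 ≤ card P
two-members {P = P} p q x≢y rewrite card-remove p =
  s≤s (member⇒card>0 (∈∖ q (λ e → x≢y (sym (⁅⁆⇒≡ e)))))

card≤1⇒≡ : ∀ {n} {P : Fin n → Bool} {x y} → card P ≤ 1 → x ∈ P → y ∈ P → x ≡ y
card≤1⇒≡ {x = x} {y} c p q with x Fin.≟ y
... | yes e  = e
... | no x≢y = ⊥-elim (<⇒≱ (two-members p q x≢y) c)

-- Closed sets of an orientation

length-cartesianProductWith : ∀ {A B C : Set} (f : A → B → C) xs ys →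
  length (List.cartesianProductWith f xs ys) ≡ length xs * length ys
length-cartesianProductWith f []       ys = refl
length-cartesianProductWith f (x ∷ xs) ys = trans (length-++ (List.map (f x) ys))
  (cong₂ _+_ (length-map (f x) ys) (length-cartesianProductWith f xs ys))

module Upsets {n : ℕ} (adj o : Fin n → Fin n → Bool)
  (adj-irrefl : ∀ {x} → x ∉ adj x)
  (adj-symm : ∀ {x y} → y ∈ adj x → x ∈ adj y)
  (o⊆adj : ∀ {x y} → y ∈ o x → y ∈ adj x)
  (oriented : ∀ {x y} → y ∈ adj x → y ∈ o x ⊎ x ∈ o y) where

  V : Set
  V = Fin n

  into : V → V → Bool
  into x y = o y x

  Up : (V → Set) → (V → Bool) → Set
  Up P s = ∀ {x y} → P x → P y → y ∈ o x → x ∈ s → y ∈ s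

  -- Upper bounds are witnessed by lists containing every member up to agreement on P; entries may repeat or be spurious.
  record SameOn (P : V → Set) (s t : V → Bool) : Set where
    constructor same
    field at : ∀ {y} → P y → s y ≡ t y

  UCov : (V → Set) → ℕ → Set
  UCov P u = Σ (List (V → Bool)) λ L → length L ≤ u ×
    (∀ s → Up P s → Any (SameOn P s) L)

  UCov-mono : ∀ {P u w} → u ≤ w → UCov P u → UCov P w
  UCov-mono u≤w (L , le , cov) = L , ≤-trans le u≤w , cov

  UCov-none : ∀ {P} → (∀ {y} → ¬ P y) → UCov P 1
  UCov-none e = (λ _ → false) ∷ [] , ≤-refl , λ s _ → here (same λ p → ⊥-elim (e p))

  -- A closed set containing `x` contains its out-neighbours, and one avoiding `x` avoids its
  -- in-neighbours. Only `P₁`, respectively `P₂`, is then undetermined, and the restriction to it is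
  -- again closed.
  UCov-branch : ∀ {P P₁ P₂ : V → Set} {x u w} → P x →
    (∀ {y} → P₁ y → P y) → (∀ {y} → P₂ y → P y) →
    (∀ {y} → P y → y ≡ x ⊎ y ∈ o x ⊎ P₁ y) →
    (∀ {y} → P y → y ≡ x ⊎ x ∈ o y ⊎ P₂ y) →
    UCov P₁ u → UCov P₂ w → UCov P (u + w)
  UCov-branch {P} {P₁} {P₂} {x} {u} {w} px P₁⊆P P₂⊆P split₁ split₂ (L₁ , le₁ , cov₁) (L₂ , le₂ , cov₂) =
    List.map f L₁ ++ List.map g L₂ ,
    subst (_≤ u + w) (sym (trans (length-++ (List.map f L₁)) (cong₂ _+_ (length-map f L₁) (length-map g L₂)))) (+-mono-≤ le₁ le₂) ,
    cov
    where
    f g : (V → Bool) → (V → Bool)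
    f t y = if does (y Fin.≟ x) ∨ o x y then true else t y
    g t y = if does (y Fin.≟ x) ∨ o y x then false else t y

    cov : ∀ s → Up P s → Any (SameOn P s) (List.map f L₁ ++ List.map g L₂)
    cov s up with s x in sx
    ... | true = Any.++⁺ˡ (Any.map⁺ (Any.map (λ (same e) → same (agree e)) (cov₁ s (λ p q → up (P₁⊆P p) (P₁⊆P q)))))
      where
      agree : ∀ {t} → (∀ {y} → P₁ y → s y ≡ t y) → ∀ {y} → P y → s y ≡ f t y
      agree {t} eq {y} py with y Fin.≟ x | o x y in oxy | split₁ py
      ... | yes refl | _     | _                    = sx
      ... | no y≢x   | true  | _                    = holds (up px py (mem oxy) (mem sx))
      ... | no y≢x   | false | inj₁ y≡x             = ⊥-elim (y≢x y≡x)
      ... | no y≢x   | false | inj₂ (inj₁ y∈o)      = ⊥-elim (false⇒∉ {P = o x} oxy y∈o)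
      ... | no y≢x   | false | inj₂ (inj₂ p₁y)      = eq p₁y
    ... | false = Any.++⁺ʳ _ (Any.map⁺ (Any.map (λ (same e) → same (agree e)) (cov₂ s (λ p q → up (P₂⊆P p) (P₂⊆P q)))))
      where
      agree : ∀ {t} → (∀ {y} → P₂ y → s y ≡ t y) → ∀ {y} → P y → s y ≡ g t y
      agree {t} eq {y} py with y Fin.≟ x | o y x in oyx | split₂ py
      ... | yes refl | _     | _                    = sx
      ... | no y≢x   | true  | _                    = ∉⇒false {P = s} λ y∈s → false⇒∉ {P = s} sx (up py px (mem oyx) y∈s)
      ... | no y≢x   | false | inj₁ y≡x             = ⊥-elim (y≢x y≡x)
      ... | no y≢x   | false | inj₂ (inj₁ x∈o)      = ⊥-elim (false⇒∉ {P = o y} oyx x∈o)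
      ... | no y≢x   | false | inj₂ (inj₂ p₂y)      = eq p₂y

  -- A closed set restricts to a closed set on either part. Arcs between the parts are ignored,
  -- which can only enlarge the bound.
  UCov-product : ∀ {N} (A : V → Bool) {u w} →
    UCov (_∈ N ∩ A) u → UCov (_∈ N ∖ A) w → UCov (_∈ N) (u * w)
  UCov-product {N} A {u} {w} (L₁ , le₁ , cov₁) (L₂ , le₂ , cov₂) =
    List.cartesianProductWith glue L₁ L₂ ,
    subst (_≤ u * w) (sym (length-cartesianProductWith glue L₁ L₂)) (*-mono-≤ le₁ le₂) ,
    λ s up → Any.cartesianProductWith⁺ glue (λ (same e₁) (same e₂) → same (agree s e₁ e₂))
      (cov₁ s (λ p q → up (∩ˡ p) (∩ˡ q))) (cov₂ s (λ p q → up (∖ˡ p) (∖ˡ q)))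
    where
    glue : (V → Bool) → (V → Bool) → (V → Bool)
    glue s t y = if A y then s y else t y
    agree : ∀ s {t₁ t₂} → (∀ {y} → y ∈ N ∩ A → s y ≡ t₁ y) → (∀ {y} → y ∈ N ∖ A → s y ≡ t₂ y) →
      ∀ {y} → y ∈ N → s y ≡ glue t₁ t₂ y
    agree s e₁ e₂ {y} y∈N with A y in a
    ... | true  = e₁ (∈∩ y∈N (mem a))
    ... | false = e₂ (∈∖ y∈N (false⇒∉ a))

  UCov-all : ∀ k N → card N ≤ k → UCov (_∈ N) (2 ^ k)
  UCov-all k N le with 1 ≤? card N
  UCov-all k       N le | no c<1  = UCov-mono (m^n>0 2 k) (UCov-none λ p → c<1 (member⇒card>0 p))
  UCov-all zero    N le | yes 1≤c with () ← ≤-trans 1≤c le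
  UCov-all (suc k) N le | yes 1≤c with x , x∈N ← card>0⇒member 1≤c =
    subst (UCov (_∈ N)) (cong (2 ^ k +_) (sym (+-identityʳ (2 ^ k))))
      (UCov-branch x∈N ∖ˡ ∖ˡ split split rest rest)
    where
    rest : UCov (_∈ N ∖ ⁅ x ⁆) (2 ^ k)
    rest = UCov-all k (N ∖ ⁅ x ⁆) (≤-pred (subst (_≤ suc k) (card-remove x∈N) le))
    split : ∀ {y} {Q : Set} → y ∈ N → y ≡ x ⊎ Q ⊎ y ∈ N ∖ ⁅ x ⁆
    split {y} y∈N with y Fin.≟ x
    ... | yes e  = inj₁ e
    ... | no y≢x = inj₂ (inj₂ (∈∖ y∈N (λ e → y≢x (⁅⁆⇒≡ e))))

  -- At most a · 2^(d - b) up-closed subsets of N.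
  record Bd (N : V → Bool) (d a b : ℕ) : Set where
    constructor bd
    field
      size    : ℕ
      covered : UCov (_∈ N) size
      bound   : size * 2 ^ b ≤ a * 2 ^ d

  Bd-weaken : ∀ {N d} a b {a′ b′} → a * 2 ^ b′ ≤ a′ * 2 ^ b → Bd N d a b → Bd N d a′ b′
  Bd-weaken {d = d} a b {a′} {b′} le (bd u cov bound) = bd u cov
    (*-cancelʳ-≤ (u * 2 ^ b′) (a′ * 2 ^ d) (2 ^ b) {{m^n≢0 2 b}} (begin
      u * 2 ^ b′ * 2 ^ b    ≡⟨ swap u (2 ^ b′) (2 ^ b) ⟩
      u * 2 ^ b * 2 ^ b′    ≤⟨ *-monoˡ-≤ (2 ^ b′) bound ⟩
      a * 2 ^ d * 2 ^ b′    ≡⟨ swap a (2 ^ d) (2 ^ b′) ⟩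
      a * 2 ^ b′ * 2 ^ d    ≤⟨ *-monoˡ-≤ (2 ^ d) le ⟩
      a′ * 2 ^ b * 2 ^ d    ≡⟨ swap a′ (2 ^ b) (2 ^ d) ⟩
      a′ * 2 ^ d * 2 ^ b    ∎))
    where
    open ≤-Reasoning
    swap : ∀ x y z → x * y * z ≡ x * z * y
    swap = solve-∀

  -- Each of `c` missing vertices is worth a factor 1/2 against the larger exponent `d`. Thus the
  -- branches at a vertex are measured on the scale of the set before branching.
  Bd-shift : ∀ {N a b} c {d} → card N + c ≤ d → Bd N (card N) a b → Bd N d a (b + c)
  Bd-shift {N} {a} {b} c {d} le (bd u cov bound) = bd u cov (begin
    u * 2 ^ (b + c)          ≡⟨ cong (u *_) (^-distribˡ-+-* 2 b c) ⟩
    u * (2 ^ b * 2 ^ c)      ≡⟨ *-assoc u _ _ ⟨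
    u * 2 ^ b * 2 ^ c        ≤⟨ *-monoˡ-≤ (2 ^ c) bound ⟩
    a * 2 ^ card N * 2 ^ c   ≡⟨ *-assoc a _ _ ⟩
    a * (2 ^ card N * 2 ^ c) ≡⟨ cong (a *_) (^-distribˡ-+-* 2 (card N) c) ⟨
    a * 2 ^ (card N + c)     ≤⟨ *-monoʳ-≤ a (^-monoʳ-≤ 2 le) ⟩
    a * 2 ^ d                ∎)
    where open ≤-Reasoning

  Bd-full : ∀ {N} c {d} → card N + c ≤ d → Bd N d 1 c
  Bd-full {N} c le = Bd-shift {a = 1} {0} c le
    (bd (2 ^ card N) (UCov-all (card N) N ≤-refl) (≤-reflexive (trans (*-identityʳ _) (sym (+-identityʳ _)))))

  Bd-product : ∀ {N} A {a b a′ b′} → Bd (N ∩ A) (card (N ∩ A)) a b → Bd (N ∖ A) (card (N ∖ A)) a′ b′ →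
    Bd N (card N) (a * a′) (b + b′)
  Bd-product {N} A {a} {b} {a′} {b′} (bd u covᵤ boundᵤ) (bd w cov bound) =
    bd (u * w) (UCov-product A covᵤ cov) (begin
      u * w * 2 ^ (b + b′)           ≡⟨ cong (u * w *_) (^-distribˡ-+-* 2 b b′) ⟩
      u * w * (2 ^ b * 2 ^ b′)       ≡⟨ middle u w (2 ^ b) (2 ^ b′) ⟩
      (u * 2 ^ b) * (w * 2 ^ b′)     ≤⟨ *-mono-≤ boundᵤ bound ⟩
      (a * 2 ^ k) * (a′ * 2 ^ k′)    ≡⟨ middle a a′ (2 ^ k) (2 ^ k′) ⟨
      a * a′ * (2 ^ k * 2 ^ k′)      ≡⟨ cong (a * a′ *_) (trans (cong (2 ^_) (card-split N A)) (^-distribˡ-+-* 2 k k′)) ⟨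
      a * a′ * 2 ^ card N            ∎)
    where
    open ≤-Reasoning
    k k′ : ℕ
    k = card (N ∩ A)
    k′ = card (N ∖ A)
    middle : ∀ p q r s → p * q * (r * s) ≡ (p * r) * (q * s)
    middle = solve-∀

  rem : (V → Bool) → V → (V → Bool) → (V → Bool)
  rem N x r = (N ∖ ⁅ x ⁆) ∖ r

  module _ {N : V → Bool} {x : V} {r : V → Bool} where
    rem⊆ : ∀ {y} → y ∈ rem N x r → y ∈ N
    rem⊆ = ∖ˡ ∘ ∖ˡ

    rem≢ : ∀ {y} → y ∈ rem N x r → y ≢ x
    rem≢ p refl = ∖ʳ (∖ˡ p) (∈⁅⁆ x)

    ∈rem : ∀ {y} → y ∈ N → y ≢ x → y ∉ r → y ∈ rem N x r
    ∈rem p y≢x q = ∈∖ (∈∖ p (y≢x ∘ ⁅⁆⇒≡)) q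

    card-rem : x ∈ N → r ⊆ adj x → card (rem N x r) + suc (card (N ∩ r)) ≡ card N
    card-rem x∈N r⊆adj = begin
      card (rem N x r) + suc (card (N ∩ r))        ≡⟨ +-suc _ _ ⟩
      suc (card (rem N x r) + card (N ∩ r))        ≡⟨ cong suc (+-comm (card (rem N x r)) _) ⟩
      suc (card (N ∩ r) + card (rem N x r))        ≡⟨ cong (λ k → suc (k + card (rem N x r)))
        (card-cong (λ p → ∈∩ (∈∖ (∩ˡ p) (λ e → adj-irrefl (r⊆adj (subst (_∈ r) (⁅⁆⇒≡ e) (∩ʳ p))))) (∩ʳ p))
                   (λ p → ∈∩ (∖ˡ (∩ˡ p)) (∩ʳ p))) ⟩
      suc (card ((N ∖ ⁅ x ⁆) ∩ r) + card (rem N x r)) ≡⟨ cong suc (card-split (N ∖ ⁅ x ⁆) r) ⟨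
      suc (card (N ∖ ⁅ x ⁆))                       ≡⟨ card-remove x∈N ⟨
      card N                                       ∎
      where open ≡-Reasoning

    degree-rem : ∀ y → card (N ∩ adj y) ≤ card (rem N x r ∩ adj y) + suc (card (N ∩ r))
    degree-rem y = begin
      card (N ∩ adj y)
        ≤⟨ card-cover {Q = rem N x r ∩ adj y} {(N ∩ adj y) ∖ (rem N x r)} split ⟩
      card (rem N x r ∩ adj y) + card ((N ∩ adj y) ∖ rem N x r)
        ≤⟨ +-monoʳ-≤ (card (rem N x r ∩ adj y)) (card-cover {Q = ⁅ x ⁆} {N ∩ r} split′) ⟩
      card (rem N x r ∩ adj y) + (card ⁅ x ⁆ + card (N ∩ r))
        ≡⟨ cong (λ k → card (rem N x r ∩ adj y) + (k + card (N ∩ r))) (card-⁅⁆ x) ⟩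
      card (rem N x r ∩ adj y) + suc (card (N ∩ r)) ∎
      where
      open ≤-Reasoning
      split : ∀ {z} → z ∈ N ∩ adj y → z ∈ rem N x r ∩ adj y ⊎ z ∈ (N ∩ adj y) ∖ rem N x r
      split {z} p with z ∈? rem N x r
      ... | yes q = inj₁ (∈∩ q (∩ʳ p))
      ... | no q  = inj₂ (∈∖ p q)
      split′ : ∀ {z} → z ∈ (N ∩ adj y) ∖ rem N x r → z ∈ ⁅ x ⁆ ⊎ z ∈ N ∩ r
      split′ {z} p with z ∈? ⁅ x ⁆ | z ∈? r
      ... | yes q | _     = inj₁ q
      ... | no _  | yes q = inj₂ (∈∩ (∩ˡ (∖ˡ p)) q)
      ... | no q  | no q′ = ⊥-elim (∖ʳ p (∈∖ (∈∖ (∩ˡ (∖ˡ p)) q) q′))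

    -- The crude estimate for one branch: `x` and at least `p` neighbours are settled, and
    -- everything else is taken to be free.
    Bd-side-full : ∀ p → x ∈ N → r ⊆ adj x → p ≤ card (N ∩ r) → Bd (rem N x r) (card N) 1 (suc p)
    Bd-side-full p x∈N r⊆adj p≤ = Bd-full (suc p)
      (subst (card (rem N x r) + suc p ≤_) (card-rem x∈N r⊆adj) (+-monoʳ-≤ (card (rem N x r)) (s≤s p≤)))

    Bd-side : ∀ p {a b} → x ∈ N → r ⊆ adj x → p ≤ card (N ∩ r) →
      Bd (rem N x r) (card (rem N x r)) a b → Bd (rem N x r) (card N) a (b + suc p)
    Bd-side p x∈N r⊆adj p≤ = Bd-shift (suc p)
      (subst (card (rem N x r) + suc p ≤_) (card-rem x∈N r⊆adj) (+-monoʳ-≤ (card (rem N x r)) (s≤s p≤)))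

  -- r₁ and r₂ are the out- and in-neighbours of x, in the order that makes card (N ∩ r₁) ≤ card (N ∩ r₂).
  Sides : (V → Bool) → V → ℕ → ℕ → Set
  Sides N x a b = ∀ r₁ r₂ → r₁ ⊆ adj x → r₂ ⊆ adj x →
    card (N ∩ adj x) ≤ card (N ∩ r₁) + card (N ∩ r₂) → card (N ∩ r₁) ≤ card (N ∩ r₂) →
    Σ ℕ λ a₁ → Σ ℕ λ a₂ → a₁ + a₂ ≤ a × Bd (rem N x r₁) (card N) a₁ b × Bd (rem N x r₂) (card N) a₂ b

  -- The branches with and without `x` exchange roles when all arcs are reversed, so a bound proved
  -- for one order of the two neighbourhood sizes serves both.
  Bd-branch : ∀ {N x a b} → x ∈ N → Sides N x a b → Bd N (card N) a b
  Bd-branch {N} {x} {a} {b} x∈N sides = [ below , above ]′ (≤-total (card (N ∩ o x)) (card (N ∩ into x)))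
    where
    into⊆adj : into x ⊆ adj x
    into⊆adj (mem p) = adj-symm (o⊆adj (mem p))

    split : ∀ {r y} → y ∈ N → y ≡ x ⊎ y ∈ r ⊎ y ∈ rem N x r
    split {r} {y} p with y Fin.≟ x | y ∈? r
    ... | yes e  | _     = inj₁ e
    ... | no _   | yes q = inj₂ (inj₁ q)
    ... | no y≢x | no q  = inj₂ (inj₂ (∈rem p y≢x q))

    combine : ∀ {a₁ a₂} → a₁ + a₂ ≤ a → Bd (rem N x (o x)) (card N) a₁ b → Bd (rem N x (into x)) (card N) a₂ b →
      Bd N (card N) a b
    combine {a₁} {a₂} le (bd u covᵤ boundᵤ) (bd w cov bound) = bd (u + w)
      (UCov-branch x∈N rem⊆ rem⊆ split (λ p → Sum.map₂ (Sum.map₁ λ { (mem q) → mem q }) (split p)) covᵤ cov) (begin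
        (u + w) * 2 ^ b                   ≡⟨ *-distribʳ-+ (2 ^ b) u w ⟩
        u * 2 ^ b + w * 2 ^ b             ≤⟨ +-mono-≤ boundᵤ bound ⟩
        a₁ * 2 ^ card N + a₂ * 2 ^ card N ≡⟨ *-distribʳ-+ (2 ^ card N) a₁ a₂ ⟨
        (a₁ + a₂) * 2 ^ card N            ≤⟨ *-monoˡ-≤ (2 ^ card N) le ⟩
        a * 2 ^ card N                    ∎)
      where
      open ≤-Reasoning

    degree : card (N ∩ adj x) ≤ card (N ∩ o x) + card (N ∩ into x)
    degree = card-cover λ p → Sum.map (∈∩ (∩ˡ p)) (λ { (mem q) → ∈∩ (∩ˡ p) (mem q) }) (oriented (∩ʳ p))

    below : card (N ∩ o x) ≤ card (N ∩ into x) → Bd N (card N) a b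
    below le with _ , _ , s , B₁ , B₂ ← sides (o x) (into x) o⊆adj into⊆adj degree le = combine s B₁ B₂

    above : card (N ∩ into x) ≤ card (N ∩ o x) → Bd N (card N) a b
    above le with a₁ , a₂ , s , B₁ , B₂ ← sides (into x) (o x) into⊆adj o⊆adj
                    (subst (card (N ∩ adj x) ≤_) (+-comm (card (N ∩ o x)) _) degree) le =
      combine (subst (_≤ a) (+-comm a₁ a₂) s) B₂ B₁

  -- Closed sets in graphs with prescribed degrees

  MinDeg : (V → Bool) → ℕ → Set
  MinDeg N m = ∀ {y} → y ∈ N → m ≤ card (N ∩ adj y)

  neighbour : ∀ {N y} → 1 ≤ card (N ∩ adj y) → ∃ λ z → z ∈ N × z ∈ adj y
  neighbour c with z , p ← card>0⇒member c = z , ∩ˡ p , ∩ʳ p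

  none∈ : ∀ {N r : V → Bool} {x : V} → card (N ∩ r) ≡ 0 → x ∈ N → x ∉ r
  none∈ c p q with () ← subst (1 ≤_) c (member⇒card>0 (∈∩ p q))

  -- Attained by a star with `D + 1` leaves whose centre `x` is a source: 2^(D+1) closed sets avoid
  -- `x` and one contains it. If `x` has both in- and out-neighbours, each branch is at most 1/4,
  -- and 1/2 in total is less.
  star : ∀ {N x} D → x ∈ N → suc D ≤ card (N ∩ adj x) → Bd N (card N) (2 ^ suc D + 1) (2 + D)
  star {N} {x} D x∈N deg = Bd-branch x∈N sides
    where
    sides : Sides N x (2 ^ suc D + 1) (2 + D)
    sides r₁ r₂ r₁⊆ r₂⊆ cover r₁≤r₂ with card (N ∩ r₁) in p
    ... | zero  = 2 ^ suc D , 1 , ≤-refl ,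
      Bd-weaken 1 1 (≤-reflexive (trans (+-identityʳ _) (*-comm 2 (2 ^ suc D)))) (Bd-side-full 0 x∈N r₁⊆ z≤n) ,
      Bd-side-full (suc D) x∈N r₂⊆ (≤-trans deg cover)
    ... | suc _ = 2 ^ D , 2 ^ D , ≤-trans (≤-reflexive (cong (2 ^ D +_) (sym (+-identityʳ (2 ^ D))))) (m≤m+n _ 1) ,
      Bd-weaken 1 2 quarter (Bd-side-full 1 x∈N r₁⊆ (subst (1 ≤_) (sym p) (s≤s z≤n))) ,
      Bd-weaken 1 2 quarter (Bd-side-full 1 x∈N r₂⊆ (≤-trans (s≤s z≤n) r₁≤r₂))
      where
      quarter : 1 * 2 ^ (2 + D) ≤ 2 ^ D * 2 ^ 2
      quarter = ≤-reflexive (arith (2 ^ D))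
        where
        arith : ∀ k → 1 * (2 * (2 * k)) ≡ k * 4
        arith = solve-∀

  edge : ∀ {N x y} → x ∈ N → y ∈ N → y ∈ adj x → Bd N (card N) 3 2
  edge x∈N y∈N xy = star 0 x∈N (member⇒card>0 (∈∩ y∈N xy))

  -- If all arcs between `x` and `N` point the same way, the edge `yz` survives in one branch,
  -- giving 1/2 · 3/4, and the other branch is at most 1/8. Otherwise both are at most 1/4.
  half : ∀ {N x y z} → x ∈ N → 2 ≤ card (N ∩ adj x) → y ∈ N → z ∈ N → z ∈ adj y → y ≢ x → z ≢ x →
    Bd N (card N) 1 1
  half {N} {x} {y} {z} x∈N deg y∈N z∈N yz y≢x z≢x = Bd-weaken 4 3 (≤ᵇ⇒≤ _ _ tt) (Bd-branch x∈N sides)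
    where
    sides : Sides N x 4 3
    sides r₁ r₂ r₁⊆ r₂⊆ cover r₁≤r₂ with card (N ∩ r₁) in p
    ... | zero  = 3 , 1 , ≤-refl ,
      Bd-side 0 x∈N r₁⊆ z≤n (edge (∈rem y∈N y≢x (none∈ p y∈N)) (∈rem z∈N z≢x (none∈ p z∈N)) yz) ,
      Bd-side-full 2 x∈N r₂⊆ (≤-trans deg cover)
    ... | suc _ = 2 , 2 , ≤-refl ,
      Bd-weaken 1 2 ≤-refl (Bd-side-full 1 x∈N r₁⊆ (subst (1 ≤_) (sym p) (s≤s z≤n))) ,
      Bd-weaken 1 2 ≤-refl (Bd-side-full 1 x∈N r₂⊆ (≤-trans (s≤s z≤n) r₁≤r₂))

  -- Each edge of a perfect matching contributes 3/4. The `suc` in the last hypothesis is parity: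
  -- the number of matched vertices is even, so five vertices already guarantee a third edge.
  matching : ∀ k {N} → MinDeg N 1 → (∀ {y} → y ∈ N → card (N ∩ adj y) ≤ 1) → k * 2 ≤ suc (card N) →
    Bd N (card N) (3 ^ k) (k * 2)
  matching zero    _  _  _ = Bd-full 0 (≤-reflexive (+-identityʳ _))
  matching (suc k) {N} δ Δ (s≤s c) with x , x∈N ← card>0⇒member {P = N} (≤-trans (s≤s z≤n) c)
    with y , y∈N , xy ← neighbour (δ x∈N) =
    Bd-product A (edge (∈∩ x∈N xA) (∈∩ y∈N yA) xy) (matching k δ′ Δ′ c′)
    where
    A : V → Bool
    A t = ⁅ x ⁆ t ∨ ⁅ y ⁆ t

    xA : x ∈ A
    xA = mem (cong (_∨ ⁅ y ⁆ x) (holds (∈⁅⁆ x)))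

    ∈A : ∀ {t} → t ∈ A → t ∈ ⁅ x ⁆ ⊎ t ∈ ⁅ y ⁆
    ∈A {t} (mem e) with ⁅ x ⁆ t in eq
    ... | true  = inj₁ (mem eq)
    ... | false = inj₂ (mem e)

    yA : y ∈ A
    yA = mem (trans (cong (⁅ x ⁆ y ∨_) (holds (∈⁅⁆ y))) (∨-zeroʳ (⁅ x ⁆ y)))

    Δ′ : ∀ {t} → t ∈ N ∖ A → card ((N ∖ A) ∩ adj t) ≤ 1
    Δ′ p = ≤-trans (card-mono (λ q → ∈∩ (∖ˡ (∩ˡ q)) (∩ʳ q))) (Δ (∖ˡ p))

    δ′ : MinDeg (N ∖ A) 1
    δ′ {t} p with s , s∈N , ts ← neighbour (δ (∖ˡ p)) = member⇒card>0 (∈∩ (∈∖ s∈N s∉A) ts)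
      where
      s∉A : s ∉ A
      s∉A q with ∈A q
      ... | inj₁ e rewrite ⁅⁆⇒≡ e = ∖ʳ p (subst (_∈ A) (card≤1⇒≡ (Δ x∈N) (∈∩ y∈N xy) (∈∩ (∖ˡ p) (adj-symm ts))) yA)
      ... | inj₂ e rewrite ⁅⁆⇒≡ e = ∖ʳ p (subst (_∈ A) (card≤1⇒≡ (Δ y∈N) (∈∩ x∈N (adj-symm xy)) (∈∩ (∖ˡ p) (adj-symm ts))) xA)

    c′ : k * 2 ≤ suc (card (N ∖ A))
    c′ = ≤-pred (begin
      suc (k * 2)                           ≤⟨ c ⟩
      card N                                ≡⟨ card-split N A ⟩
      card (N ∩ A) + card (N ∖ A)           ≤⟨ +-monoˡ-≤ _ (≤-trans (card-mono ∩ʳ) (card-cover ∈A)) ⟩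
      card ⁅ x ⁆ + card ⁅ y ⁆ + card (N ∖ A) ≡⟨ cong₂ (λ a b → a + b + card (N ∖ A)) (card-⁅⁆ x) (card-⁅⁆ y) ⟩
      2 + card (N ∖ A)                      ∎)
      where open ≤-Reasoning

  -- If no degree exceeds 1, the graph is a perfect matching. If `x` has degree at least 2, either
  -- some edge avoids `x` and `half` applies, or every other vertex has its neighbour at `x` and
  -- `star` applies.
  minDeg₁ : ∀ D k {N} → MinDeg N 1 → 2 + D ≤ card N → k * 2 ≤ suc (card N) → 1 ≤ D →
    Bd N (card N) 1 1 ⊎ Bd N (card N) (2 ^ suc D + 1) (2 + D) ⊎ Bd N (card N) (3 ^ k) (k * 2)
  minDeg₁ D k {N} δ D<c k≤c 1≤D with any? (λ x → (x ∈? N) ×-dec (2 ≤? card (N ∩ adj x)))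
  ... | no none = inj₂ (inj₂ (matching k δ (λ {y} p → ≤-pred (≰⇒> λ q → none (y , p , q))) k≤c))
  ... | yes (x , x∈N , deg)
    with any? (λ y → (y ∈? (N ∖ ⁅ x ⁆)) ×-dec any? (λ z → (z ∈? (N ∖ ⁅ x ⁆)) ×-dec (z ∈? adj y)))
  ... | yes (y , p , z , q , yz) =
    inj₁ (half x∈N deg (∖ˡ p) (∖ˡ q) yz (λ { refl → ∖ʳ p (∈⁅⁆ x) }) (λ { refl → ∖ʳ q (∈⁅⁆ x) }))
  ... | no none = inj₂ (inj₁ (star D x∈N (≤-pred (begin
    2 + D                          ≤⟨ D<c ⟩
    card N                         ≡⟨ card-remove x∈N ⟩
    suc (card (N ∖ ⁅ x ⁆))         ≤⟨ s≤s (card-mono universal) ⟩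
    suc (card (N ∩ adj x))         ∎))))
    where
    open ≤-Reasoning
    universal : (N ∖ ⁅ x ⁆) ⊆ (N ∩ adj x)
    universal {y} p with z , z∈N , yz ← neighbour (δ (∖ˡ p)) with z Fin.≟ x
    ... | yes refl = ∈∩ (∖ˡ p) (adj-symm yz)
    ... | no z≢x   = ⊥-elim (none (y , p , z , ∈∖ z∈N (z≢x ∘ ⁅⁆⇒≡) , yz))

  -- Star and matching tie here: (2^3 + 1) / 2^4 = (3/4)^2.
  minDeg₁-4 : ∀ {N} → MinDeg N 1 → 4 ≤ card N → Bd N (card N) 9 4
  minDeg₁-4 δ c with minDeg₁ 2 2 δ c (≤-trans c (n≤1+n _)) (s≤s z≤n)
  ... | inj₁ B        = Bd-weaken 1 1 (≤ᵇ⇒≤ _ _ tt) B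
  ... | inj₂ (inj₁ B) = B
  ... | inj₂ (inj₂ B) = B

  -- The star with four leaves gives 17/32; a matching now has three edges and yields only 27/64.
  minDeg₁-5 : ∀ {N} → MinDeg N 1 → 5 ≤ card N → Bd N (card N) 17 5
  minDeg₁-5 δ c with minDeg₁ 3 3 δ c (s≤s c) (s≤s z≤n)
  ... | inj₁ B        = Bd-weaken 1 1 (≤ᵇ⇒≤ _ _ tt) B
  ... | inj₂ (inj₁ B) = B
  ... | inj₂ (inj₂ B) = Bd-weaken 27 6 (≤ᵇ⇒≤ _ _ tt) B

  minDeg-rem : ∀ {N x r m} k → MinDeg N (suc k + m) → card (N ∩ r) ≤ k → MinDeg (rem N x r) m
  minDeg-rem {N} {x} {r} {m} k δ c {y} p = +-cancelʳ-≤ (suc k) m _ (begin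
    m + suc k                                     ≡⟨ +-comm m (suc k) ⟩
    suc k + m                                     ≤⟨ δ (rem⊆ p) ⟩
    card (N ∩ adj y)                              ≤⟨ degree-rem y ⟩
    card (rem N x r ∩ adj y) + suc (card (N ∩ r)) ≤⟨ +-monoʳ-≤ _ (s≤s c) ⟩
    card (rem N x r ∩ adj y) + suc k              ∎)
    where open ≤-Reasoning

  card-rem-≥ : ∀ {N x r} k m → x ∈ N → r ⊆ adj x → card (N ∩ r) ≤ k → suc k + m ≤ card N → m ≤ card (rem N x r)
  card-rem-≥ {N} {x} {r} k m x∈N r⊆ c le = +-cancelʳ-≤ (suc k) m _ (begin
    m + suc k                              ≡⟨ +-comm m (suc k) ⟩
    suc k + m                              ≤⟨ le ⟩
    card N                                 ≡⟨ card-rem x∈N r⊆ ⟨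
    card (rem N x r) + suc (card (N ∩ r))  ≤⟨ +-monoʳ-≤ _ (s≤s c) ⟩
    card (rem N x r) + suc k               ∎)
    where open ≤-Reasoning

  -- Improves on 1/2, the value for a transitive triangle. In units of 1/32, branching at a vertex
  -- of degree at least 3 yields 9 + 2 or 8 + 4. If all degrees are 2, an edge survives in every
  -- branch that removes neighbours of `x`, which yields 9 + 3 or 6 + 6.
  minDeg₂-5 : ∀ {N} → MinDeg N 2 → 5 ≤ card N → Bd N (card N) 3 3
  minDeg₂-5 {N} δ c with any? (λ x → (x ∈? N) ×-dec (3 ≤? card (N ∩ adj x)))
  ... | yes (x , x∈N , deg) = Bd-weaken 12 5 (≤ᵇ⇒≤ _ _ tt) (Bd-branch x∈N sides)
    where
    sides : Sides N x 12 5
    sides r₁ r₂ r₁⊆ r₂⊆ cover r₁≤r₂ with card (N ∩ r₁) in p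
    ... | zero  = 9 , 2 , ≤ᵇ⇒≤ _ _ tt ,
      Bd-side 0 x∈N r₁⊆ z≤n (minDeg₁-4 (minDeg-rem 0 δ (≤-reflexive p)) (card-rem-≥ 0 4 x∈N r₁⊆ (≤-reflexive p) c)) ,
      Bd-weaken 1 4 ≤-refl (Bd-side-full 3 x∈N r₂⊆ (≤-trans deg cover))
    ... | suc k = 8 , 4 , ≤-refl ,
      Bd-weaken 1 2 ≤-refl (Bd-side-full 1 x∈N r₁⊆ (subst (1 ≤_) (sym p) (s≤s z≤n))) ,
      Bd-weaken 1 3 ≤-refl (Bd-side-full 2 x∈N r₂⊆ (larger k deg cover r₁≤r₂))
      where
      larger : ∀ k {d q} → 3 ≤ d → d ≤ suc k + q → suc k ≤ q → 2 ≤ q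
      larger zero    deg cover _  = ≤-pred (≤-trans deg cover)
      larger (suc k) _   _     le = ≤-trans (s≤s (s≤s z≤n)) le
  ... | no none with x , x∈N ← card>0⇒member (≤-trans (s≤s z≤n) c) =
    Bd-weaken 12 5 (≤ᵇ⇒≤ _ _ tt) (Bd-branch x∈N (λ r₁ r₂ → sides r₁ r₂))
    where
    deg≤2 : ∀ {y} → y ∈ N → card (N ∩ adj y) ≤ 2
    deg≤2 p = ≤-pred (≰⇒> λ q → none (_ , p , q))

    ∩⊆ : ∀ {r x} → r ⊆ adj x → (N ∩ r) ⊆ (N ∩ adj x)
    ∩⊆ r⊆ p = ∈∩ (∩ˡ p) (r⊆ (∩ʳ p))

    ≤2 : ∀ {r} → r ⊆ adj x → card (N ∩ r) ≤ 2
    ≤2 r⊆ = ≤-trans (card-mono (∩⊆ r⊆)) (deg≤2 x∈N)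

    -- Otherwise every remaining vertex is adjacent to the same vertex a of r, which then has degree at least 3.
    remaining-edge : ∀ r → r ⊆ adj x → 1 ≤ card (N ∩ r) → Bd (rem N x r) (card (rem N x r)) 3 2
    remaining-edge r r⊆ c₁ with any? (λ y → (y ∈? rem N x r) ×-dec any? (λ z → (z ∈? rem N x r) ×-dec (z ∈? adj y)))
    ... | yes (y , p , z , q , yz) = edge p q yz
    ... | no indep with a , a∈ ← card>0⇒member {P = N ∩ r} c₁ =
      ⊥-elim (<⇒≱ (≤-trans (s≤s two) three) (deg≤2 (∩ˡ a∈)))
      where
      two : 2 ≤ card (rem N x r)
      two = card-rem-≥ 2 2 x∈N r⊆ (≤2 r⊆) c

      others : ∀ {z} → z ∈ rem N x r → a ∉ adj z → ∀ {t} → t ∈ N ∩ adj z → t ∈ ⁅ x ⁆ ⊎ t ∈ (N ∩ r) ∖ ⁅ a ⁆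
      others {z} p a∉ {t} q with t ∈? ⁅ x ⁆ | t ∈? r
      ... | yes e | _     = inj₁ e
      ... | no _  | yes s = inj₂ (∈∖ (∈∩ (∩ˡ q) s) λ e → a∉ (subst (_∈ adj z) (⁅⁆⇒≡ e) (∩ʳ q)))
      ... | no e  | no s  = ⊥-elim (indep (z , p , t , ∈∖ (∈∖ (∩ˡ q) e) s , ∩ʳ q))

      adjacent : ∀ {z} → z ∈ rem N x r → a ∈ adj z
      adjacent {z} p with a ∈? adj z
      ... | yes q = q
      ... | no a∉ with 2 ≤? card (N ∩ r)
      ... | no r<2 = ⊥-elim (<⇒≱ (δ (rem⊆ p)) (begin
        card (N ∩ adj z)                       ≤⟨ card-cover (others p a∉) ⟩
        card ⁅ x ⁆ + card ((N ∩ r) ∖ ⁅ a ⁆)    ≡⟨ cong (_+ card ((N ∩ r) ∖ ⁅ a ⁆)) (card-⁅⁆ x) ⟩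
        suc (card ((N ∩ r) ∖ ⁅ a ⁆))           ≡⟨ card-remove a∈ ⟨
        card (N ∩ r)                           ≤⟨ ≤-pred (≰⇒> r<2) ⟩
        1                                      ∎))
        where open ≤-Reasoning
      ... | yes 2≤r = ⊥-elim (<⇒≱ (δ (rem⊆ p)) (begin
        card (N ∩ adj z)                       ≤⟨ card-mono (λ q →
          [ (λ e → ⊥-elim (x∉ (subst (_∈ adj z) (⁅⁆⇒≡ e) (∩ʳ q)))) , id ]′ (others p a∉ q)) ⟩
        card ((N ∩ r) ∖ ⁅ a ⁆)                 ≤⟨ ≤-pred (subst (_≤ 2) (card-remove a∈) (≤2 r⊆)) ⟩
        1                                      ∎))
        where
        open ≤-Reasoning
        -- `r` already contains two neighbours of `x`, which has no others, so `z` outside `r` is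
        -- not adjacent to `x`.
        x∉ : x ∉ adj z
        x∉ q = ∖ʳ p (∩ʳ (⊆-card-≥⇒⊇ (∩⊆ r⊆) (≤-trans (deg≤2 x∈N) 2≤r) (∈∩ (rem⊆ p) (adj-symm q))))

      three : suc (card (rem N x r)) ≤ card (N ∩ adj a)
      three = begin
        suc (card (rem N x r))            ≡⟨ cong (_+ card (rem N x r)) (card-⁅⁆ x) ⟨
        card ⁅ x ⁆ + card (rem N x r)
          ≤⟨ card-disjoint
               (λ e → subst (_∈ N ∩ adj a) (sym (⁅⁆⇒≡ e)) (∈∩ x∈N (adj-symm (r⊆ (∩ʳ a∈)))))
               (λ p → ∈∩ (rem⊆ p) (adj-symm (adjacent p)))
               (λ e p → rem≢ p (⁅⁆⇒≡ e)) ⟩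
        card (N ∩ adj a)                  ∎
        where open ≤-Reasoning

    sides : Sides N x 12 5
    sides r₁ r₂ r₁⊆ r₂⊆ cover r₁≤r₂ with card (N ∩ r₁) in p
    ... | zero  = 9 , 3 , ≤-refl ,
      Bd-side 0 x∈N r₁⊆ z≤n (minDeg₁-4 (minDeg-rem 0 δ (≤-reflexive p)) (card-rem-≥ 0 4 x∈N r₁⊆ (≤-reflexive p) c)) ,
      Bd-side 2 x∈N r₂⊆ deg (remaining-edge r₂ r₂⊆ (≤-trans (s≤s z≤n) deg))
      where
      deg : 2 ≤ card (N ∩ r₂)
      deg = ≤-trans (δ x∈N) cover
    ... | suc _ = 6 , 6 , ≤-refl ,
      Bd-weaken 3 4 ≤-refl (Bd-side 1 x∈N r₁⊆ c₁ (remaining-edge r₁ r₁⊆ c₁)) ,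
      Bd-weaken 3 4 ≤-refl (Bd-side 1 x∈N r₂⊆ c₂ (remaining-edge r₂ r₂⊆ c₂))
      where
      c₁ : 1 ≤ card (N ∩ r₁)
      c₁ = subst (1 ≤_) (sym p) (s≤s z≤n)
      c₂ : 1 ≤ card (N ∩ r₂)
      c₂ = ≤-trans (s≤s z≤n) r₁≤r₂

  -- In units of 1/64 the branches give 12 + 4, 9 + 8 or 8 + 8, according to whether the smaller
  -- side of `x` has 0, 1 or more vertices. Removing a side of size 0 or 1 leaves minimum degree 2
  -- or 1 on enough vertices for the preceding bounds. The general bound would give 20.
  minDeg₃-6 : ∀ {N} → MinDeg N 3 → 6 ≤ card N → Bd N (card N) 17 6
  minDeg₃-6 {N} δ c with x , x∈N ← card>0⇒member {P = N} (≤-trans (s≤s z≤n) c) = Bd-branch x∈N sides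
    where
    sides : Sides N x 17 6
    sides r₁ r₂ r₁⊆ r₂⊆ cover r₁≤r₂ with card (N ∩ r₁) in p
    ... | zero  = 12 , 4 , ≤ᵇ⇒≤ _ _ tt ,
      Bd-weaken 3 4 ≤-refl (Bd-side 0 x∈N r₁⊆ z≤n
        (minDeg₂-5 (minDeg-rem 0 δ (≤-reflexive p)) (card-rem-≥ 0 5 x∈N r₁⊆ (≤-reflexive p) c))) ,
      Bd-weaken 1 4 ≤-refl (Bd-side-full 3 x∈N r₂⊆ (≤-trans (δ x∈N) cover))
    ... | suc zero = 9 , 8 , ≤-refl ,
      Bd-side 1 x∈N r₁⊆ (≤-reflexive (sym p))
        (minDeg₁-4 (minDeg-rem 1 δ (≤-reflexive p)) (card-rem-≥ 1 4 x∈N r₁⊆ (≤-reflexive p) c)) ,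
      Bd-weaken 1 3 ≤-refl (Bd-side-full 2 x∈N r₂⊆ (≤-pred (≤-trans (δ x∈N) cover)))
    ... | suc (suc _) = 8 , 8 , ≤ᵇ⇒≤ _ _ tt ,
      Bd-weaken 1 3 ≤-refl (Bd-side-full 2 x∈N r₁⊆ (subst (2 ≤_) (sym p) (s≤s (s≤s z≤n)))) ,
      Bd-weaken 1 3 ≤-refl (Bd-side-full 2 x∈N r₂⊆ (≤-trans (s≤s (s≤s z≤n)) r₁≤r₂))

  -- Complete graphs on m + 1 vertices attain this bound.
  minDeg-bound : ∀ m {N} → 1 ≤ card N → MinDeg N m → Bd N (card N) (2 + m) (suc m)
  minDeg-bound m = go m ≤-refl
    where
    go : ∀ {k} m → m ≤ k → ∀ {N} → 1 ≤ card N → MinDeg N m → Bd N (card N) (2 + m) (suc m)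
    go zero _ _ _ = Bd-weaken 1 0 ≤-refl (Bd-full 0 (≤-reflexive (+-identityʳ _)))
    go {suc k} (suc m) (s≤s m≤k) {N} c δ with x , x∈N ← card>0⇒member {P = N} c = Bd-branch x∈N sides
      where
      -- Let p be `card (N ∩ r)`. If p ≤ `m`, the rest has minimum degree at least `m ∸ p`, so
      -- recursion bounds its closed sets, and p + 1 vertices are gone; the exponents add up to
      -- `2 + m` whatever p is. If p > `m`, the crude estimate suffices.
      side : ∀ r → r ⊆ adj x → Bd (rem N x r) (card N) (suc (suc m ∸ card (N ∩ r))) (2 + m)
      side r r⊆ with suc m ≤? card (N ∩ r)
      ... | yes le rewrite m≤n⇒m∸n≡0 le = Bd-side-full (suc m) x∈N r⊆ le
      ... | no gt = subst₂ (Bd (rem N x r) (card N)) (sym exponent) total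
        (Bd-side (card (N ∩ r)) x∈N r⊆ ≤-refl (go m′ (≤-trans (m∸n≤m m (card (N ∩ r))) m≤k) nonempty
          (minDeg-rem {m = m′} (card (N ∩ r)) (λ {y} q → subst (_≤ card (N ∩ adj y)) (sym (cong suc split)) (δ q)) ≤-refl)))
        where
        r≤m : card (N ∩ r) ≤ m
        r≤m = ≤-pred (≰⇒> gt)
        m′ : ℕ
        m′ = m ∸ card (N ∩ r)
        split : card (N ∩ r) + m′ ≡ m
        split = m+[n∸m]≡n r≤m
        exponent : suc (suc m ∸ card (N ∩ r)) ≡ 2 + m′
        exponent = cong suc (+-∸-assoc 1 r≤m)
        total : suc m′ + suc (card (N ∩ r)) ≡ 2 + m
        total = cong suc (trans (+-suc m′ _) (cong suc (trans (+-comm m′ _) split)))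
        x∉ : x ∉ adj x
        x∉ = adj-irrefl
        nonempty : 1 ≤ card (rem N x r)
        nonempty = card-rem-≥ (card (N ∩ r)) 1 x∈N r⊆ ≤-refl (begin
          suc (card (N ∩ r)) + 1            ≡⟨ +-comm _ 1 ⟩
          2 + card (N ∩ r)                  ≤⟨ s≤s (s≤s r≤m) ⟩
          2 + m                             ≤⟨ s≤s (δ x∈N) ⟩
          suc (card (N ∩ adj x))            ≤⟨ s≤s (card-mono (λ p → ∈∖ (∩ˡ p) λ e → x∉ (subst (_∈ adj x) (⁅⁆⇒≡ e) (∩ʳ p)))) ⟩
          suc (card (N ∖ ⁅ x ⁆))            ≡⟨ card-remove x∈N ⟨
          card N                            ∎)
          where open ≤-Reasoning

      sides : Sides N x (3 + m) (2 + m)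
      sides r₁ r₂ r₁⊆ r₂⊆ cover _ = _ , _ , total , side r₁ r₁⊆ , side r₂ r₂⊆
        where
        -- The bound closes here: the two sides together have at least `m` vertices, so their
        -- shortfalls from `m` add up to at most `m`.
        monus : ∀ m p q → m ≤ p + q → (m ∸ p) + (m ∸ q) ≤ m
        monus m p q le with ≤-total m p
        ... | inj₁ m≤p rewrite m≤n⇒m∸n≡0 m≤p = m∸n≤m m q
        ... | inj₂ p≤m = begin
          (m ∸ p) + (m ∸ q) ≤⟨ +-monoʳ-≤ (m ∸ p) (m≤n+o⇒m∸n≤o m q (subst (m ≤_) (+-comm p q) le)) ⟩
          (m ∸ p) + p       ≡⟨ m∸n+n≡m p≤m ⟩
          m                 ∎
          where open ≤-Reasoning
        total : suc (suc m ∸ card (N ∩ r₁)) + suc (suc m ∸ card (N ∩ r₂)) ≤ 3 + m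
        total = s≤s (subst (_≤ 2 + m) (sym (+-suc (suc m ∸ card (N ∩ r₁)) _))
          (s≤s (monus (suc m) (card (N ∩ r₁)) (card (N ∩ r₂)) (≤-trans (δ x∈N) cover))))

-- Elimination of a vertex

<ᵇ-flip : ∀ m n → m ≢ n → (n <ᵇ m) ≡ not (m <ᵇ n)
<ᵇ-flip zero    zero    m≢n = ⊥-elim (m≢n refl)
<ᵇ-flip zero    (suc n) m≢n = refl
<ᵇ-flip (suc m) zero    m≢n = refl
<ᵇ-flip (suc m) (suc n) m≢n = <ᵇ-flip m n (m≢n ∘ cong suc)

≺-flip : ∀ {n} {x y : Fin n} → x ≢ y → (y ≺ x) ≡ not (x ≺ y)
≺-flip x≢y = <ᵇ-flip _ _ (x≢y ∘ Fin.toℕ-injective)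

module Orientations {n : ℕ} (G : Graph n) where

  adj-irrefl : ∀ {x} → x ∉ adj G x
  adj-irrefl {x} = false⇒∉ {P = adj G x} (adj-irr G x)

  adj-symm : ∀ {x y} → y ∈ adj G x → x ∈ adj G y
  adj-symm {x} {y} (mem e) = mem (trans (adj-sym G y x) e)

  adj⇒≢ : ∀ {x y} → y ∈ adj G x → x ≢ y
  adj⇒≢ p refl = adj-irrefl p

  arc⊆adj : ∀ {σ x y} → y ∈ arc G σ x → y ∈ adj G x
  arc⊆adj {x = x} {y} (mem e) with adj G x y in a
  ... | true = mem a

  arc-false : ∀ σ {x y} → y ∉ adj G x → arc G σ x y ≡ false
  arc-false σ {x} {y} y∉ rewrite ∉⇒false {P = adj G x} y∉ = refl

  arc-value : ∀ σ {x y} → y ∈ adj G x → arc G σ x y ≡ (if x ≺ y then σ x y else not (σ y x))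
  arc-value σ (mem e) rewrite e = refl

  arc-flip : ∀ σ {x y} → y ∈ adj G x → arc G σ y x ≡ not (arc G σ x y)
  arc-flip σ {x} {y} p rewrite arc-value σ p | arc-value σ (adj-symm p) | ≺-flip (adj⇒≢ p) with x ≺ y
  ... | true  = refl
  ... | false = sym (not-involutive (σ y x))

  arc-oriented : ∀ σ {x y} → y ∈ adj G x → y ∈ arc G σ x ⊎ x ∈ arc G σ y
  arc-oriented σ {x} {y} p with arc G σ x y in e
  ... | true  = inj₁ (mem e)
  ... | false = inj₂ (mem (trans (arc-flip σ p) (cong not e)))

  module At (σ : Code n) =
    Upsets (adj G) (arc G σ) adj-irrefl adj-symm (arc⊆adj {σ}) (arc-oriented σ)

  Free : (Fin n → Set) → Code n → Set
  Free P σ = ∀ {x y z} → P x → P y → P z → y ∈ arc G σ x → z ∈ arc G σ y → x ∉ arc G σ z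

  -- Arcs are compared instead of codes, because a code may hold anything at pairs that are not
  -- edges with the smaller vertex first.
  record Agree (P : Fin n → Set) (σ τ : Code n) : Set where
    constructor agreeing
    field at : ∀ {x y} → P x → P y → arc G σ x y ≡ arc G τ x y

  DCov : (Fin n → Set) → ℕ → Set
  DCov P k = Σ (List (Code n)) λ L → length L ≤ k ×
    (∀ σ → Free P σ → Any (Agree P σ) L)

  DCov-mono : ∀ {P k l} → k ≤ l → DCov P k → DCov P l
  DCov-mono k≤l (L , le , cov) = L , ≤-trans le k≤l , cov

  DCov-resp : ∀ {P Q k} → (∀ {x} → P x → Q x) → (∀ {x} → Q x → P x) → DCov P k → DCov Q k
  DCov-resp P⊆Q Q⊆P (L , le , cov) = L , le , λ σ free →
    Any.map (λ (agreeing agree) → agreeing λ p q → agree (Q⊆P p) (Q⊆P q)) (cov σ (λ p q r → free (P⊆Q p) (P⊆Q q) (P⊆Q r)))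

  DCov-none : ∀ {P} → (∀ {x} → ¬ P x) → DCov P 1
  DCov-none e = (λ _ _ → false) ∷ [] , ≤-refl , λ σ _ → here (agreeing λ p → ⊥-elim (e p))

  -- `s` becomes the out-neighbourhood of `v`. It is negated in the column of `v` because `arc`
  -- negates the entry at (y, v) when y precedes `v`.
  extend : Fin n → Code n → (Fin n → Bool) → Code n
  extend v τ s i j = if does (i Fin.≟ v) then s j else if does (j Fin.≟ v) then not (s i) else τ i j

  arc-extend : ∀ {v τ s y} → y ∈ adj G v → arc G (extend v τ s) v y ≡ s y
  arc-extend {v} {τ} {s} {y} p rewrite arc-value (extend v τ s) p with v ≺ y | v Fin.≟ v | y Fin.≟ v
  ... | _     | no v≢v | _        = ⊥-elim (v≢v refl)
  ... | _     | yes _  | yes refl = ⊥-elim (adj-irrefl p)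
  ... | true  | yes _  | no _     = refl
  ... | false | yes _  | no _     = not-involutive (s y)

  arc-extend-≢ : ∀ {v τ s x y} → x ≢ v → y ≢ v → arc G (extend v τ s) x y ≡ arc G τ x y
  arc-extend-≢ {v} {x = x} {y} x≢v y≢v with x Fin.≟ v | y Fin.≟ v
  ... | yes e | _     = ⊥-elim (x≢v e)
  ... | no _  | yes e = ⊥-elim (y≢v e)
  ... | no _  | no _  = refl

  -- Since every triangle at v is transitive, the out-neighbourhood of v is closed under the arcs between neighbours of v.
  eliminate : ∀ {P P′ N : Fin n → Set} {v k u} → P v →
    (∀ {y} → P′ y → P y) → (∀ {y} → P′ y → y ≢ v) → (∀ {y} → P y → y ≡ v ⊎ P′ y) →
    (∀ {y} → N y → P′ y) → (∀ {y} → N y → y ∈ adj G v) → (∀ {y} → P′ y → y ∈ adj G v → N y) →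
    DCov P′ k → (∀ τ → At.UCov τ N u) → DCov P (k * u)
  eliminate {P} {P′} {N} {v} {k} {u} pv P′⊆P P′≢v split N⊆P′ N⊆adj adj⊆N (L , le , cov) ups =
    List.concatMap extensions L , ≤-trans (length-extensions L) (*-monoˡ-≤ u le) , covers
    where
    extensions : Code n → List (Code n)
    extensions τ = List.map (extend v τ) (proj₁ (ups τ))

    length-extensions : ∀ L → length (List.concatMap extensions L) ≤ length L * u
    length-extensions []      = z≤n
    length-extensions (τ ∷ L) rewrite length-++ (extensions τ) {List.concatMap extensions L}
      | length-map (extend v τ) (proj₁ (ups τ)) = +-mono-≤ (proj₁ (proj₂ (ups τ))) (length-extensions L)

    covers : ∀ σ → Free P σ →
      Any (Agree P σ) (List.concatMap extensions L)
    covers σ free = Any.concatMap⁺ extensions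
      (Any.map inner (cov σ (λ p q r → free (P′⊆P p) (P′⊆P q) (P′⊆P r))))
      where
      inner : ∀ {τ} → Agree P′ σ τ → Any (Agree P σ) (extensions τ)
      inner {τ} (agreeing agree) = Any.map⁺ (Any.map (λ { (At.same e) → agreeing (agrees e) }) (proj₂ (proj₂ (ups τ)) (arc G σ v) up))
        where
        up : At.Up τ N (arc G σ v)
        up {x} {y} nx ny (mem xy) x∈ with arc-oriented σ (N⊆adj ny)
        ... | inj₁ q = q
        ... | inj₂ q = ⊥-elim (free pv (P′⊆P (N⊆P′ nx)) (P′⊆P (N⊆P′ ny)) x∈
                         (mem (trans (agree (N⊆P′ nx) (N⊆P′ ny)) xy)) q)

        module _ {t : Fin n → Bool} (e : ∀ {y} → N y → arc G σ v y ≡ t y) where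
          at-v : ∀ {y} → P′ y → arc G σ v y ≡ arc G (extend v τ t) v y
          at-v {y} p with y ∈? adj G v
          ... | yes q = trans (e (adj⊆N p q)) (sym (arc-extend {τ = τ} q))
          ... | no q  = trans (arc-false σ q) (sym (arc-false (extend v τ t) q))

          agrees : ∀ {x y} → P x → P y → arc G σ x y ≡ arc G (extend v τ t) x y
          agrees {x} {y} px py with split px | split py
          ... | inj₁ refl | inj₁ refl = trans (arc-false σ adj-irrefl) (sym (arc-false (extend v τ t) adj-irrefl))
          ... | inj₁ refl | inj₂ p′y  = at-v p′y
          ... | inj₂ p′x  | inj₂ p′y  = trans (agree p′x p′y) (sym (arc-extend-≢ {τ = τ} {t} (P′≢v p′x) (P′≢v p′y)))
          ... | inj₂ p′x  | inj₁ refl with x ∈? adj G y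
          ... | yes q = trans (arc-flip σ q) (trans (cong not (at-v p′x)) (sym (arc-flip (extend v τ t) q)))
          ... | no q  = trans (arc-false σ (q ∘ adj-symm)) (sym (arc-false (extend v τ t) (q ∘ adj-symm)))

  ∖-split : ∀ {S : Fin n → Bool} {v y} → y ∈ S → y ≡ v ⊎ y ∈ S ∖ ⁅ v ⁆
  ∖-split {v = v} {y} p with y Fin.≟ v
  ... | yes e  = inj₁ e
  ... | no y≢v = inj₂ (∈∖ p (y≢v ∘ ⁅⁆⇒≡))

  ∖-≢ : ∀ {S : Fin n → Bool} {v y} → y ∈ S ∖ ⁅ v ⁆ → y ≢ v
  ∖-≢ p refl = ∖ʳ p (∈⁅⁆ _)

  eliminate-Bd : ∀ {S v k a b} c → v ∈ S → DCov (_∈ S ∖ ⁅ v ⁆) k →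
    (∀ τ → At.Bd τ (S ∩ adj G v) (card (S ∩ adj G v)) a b) →
    a * 2 ^ card (S ∩ adj G v) ≤ c * 2 ^ b → DCov (_∈ S) (k * c)
  eliminate-Bd {S} {v} {k} {a} {b} c v∈S D bound le =
    eliminate v∈S ∖ˡ ∖-≢ ∖-split
      (λ p → ∈∖ (∩ˡ p) λ e → adj⇒≢ (∩ʳ p) (sym (⁅⁆⇒≡ e))) ∩ʳ (λ p q → ∈∩ (∖ˡ p) q) D ups
    where
    ups : ∀ τ → At.UCov τ (_∈ S ∩ adj G v) c
    ups τ with At.bd u cov le′ ← bound τ =
      At.UCov-mono τ (*-cancelʳ-≤ u c (2 ^ b) {{m^n≢0 2 b}} (≤-trans le′ le)) cov

  min-degree : ∀ (S : Fin n → Bool) → 1 ≤ card S →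
    ∃ λ v → v ∈ S × (∀ {w} → w ∈ S → card (S ∩ adj G v) ≤ card (S ∩ adj G w))
  min-degree S c with x , x∈S ← card>0⇒member {P = S} c = go (card (S ∩ adj G x)) x∈S ≤-refl
    where
    go : ∀ d {x} → x ∈ S → card (S ∩ adj G x) ≤ d →
      ∃ λ v → v ∈ S × (∀ {w} → w ∈ S → card (S ∩ adj G v) ≤ card (S ∩ adj G w))
    go d {x} x∈S le with any? (λ y → (y ∈? S) ×-dec (card (S ∩ adj G y) <? card (S ∩ adj G x)))
    go d       {x} x∈S le | no none = x , x∈S , λ {w} w∈S → ≮⇒≥ λ lt → none (w , w∈S , lt)
    go zero    {x} x∈S le | yes (y , y∈S , lt) with () ← ≤-trans lt le
    go (suc d) {x} x∈S le | yes (y , y∈S , lt) = go d y∈S (≤-pred (≤-trans lt le))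

-- At most seven vertices

module Search {k : ℕ} (m : Fin k → Fin k → Bool) where

  -- Whichever way the edge xy is oriented, y is forced in one of the two branches at x.
  splits : Fin k → List (Fin k) → List (List (Fin k) × List (Fin k))
  splits x []       = ([] , []) ∷ []
  splits x (y ∷ ys) = if m x y
    then List.map (λ (a , b) → y ∷ a , b) (splits x ys) ++ List.map (λ (a , b) → a , y ∷ b) (splits x ys)
    else List.map (λ (a , b) → y ∷ a , y ∷ b) (splits x ys)

  -- Bounds the number of up-closed sets for every orientation, provided that the fuel is at least the length.
  maxUp : ℕ → List (Fin k) → ℕ
  maxUp _       []       = 1
  maxUp zero    (_ ∷ _)  = 0
  maxUp (suc l) (x ∷ xs) = List.foldr (λ (a , b) r → (maxUp l a + maxUp l b) ⊔ r) 0 (splits x xs)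

  without : Fin k → List (Fin k) → List (Fin k)
  without v = filterᵇ (λ y → not (does (y Fin.≟ v)))

  -- Looks for an elimination order whose cost stays within `t`, not necessarily by minimum degree;
  -- `acc` is the cost so far. The search may stop at any proper subset, where the induction
  -- hypothesis supplies a factorial; `length vs <ᵇ k` keeps this from being circular.
  search : ℕ → ℕ → List (Fin k) → ℕ → Bool
  search zero    t vs acc = false
  search (suc l) t vs acc = ((length vs <ᵇ k) ∧ ((length vs !) * acc ≤ᵇ t)) ∨
    any (λ v → let ws = without v vs ; ns = filterᵇ (m v) ws ; u = acc * maxUp (length ns) ns in
               (u ≤ᵇ t) ∧ search l t ws u) vs

  degree≥ : ℕ → Bool
  degree≥ d = List.foldr (λ i r → (d ≤ᵇ count (m i)) ∧ r) true (allFin k)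

-- Each new vertex brings its row of adjacencies to the earlier ones. This codes every labelled
-- graph exactly once, so that a statement about all graphs becomes a quantification over Boolean
-- rows.
data Triangular : ℕ → Set where
  []  : Triangular 0
  _∷_ : ∀ {k} → Vec Bool k → Triangular k → Triangular (suc k)

matrix : ∀ {k} → Triangular k → Fin k → Fin k → Bool
matrix (r ∷ t) zero    zero    = false
matrix (r ∷ t) zero    (suc j) = Vec.lookup r j
matrix (r ∷ t) (suc i) zero    = Vec.lookup r i
matrix (r ∷ t) (suc i) (suc j) = matrix t i j

allRows : ∀ k → (Vec Bool k → Bool) → Bool
allRows zero    P = P []
allRows (suc k) P = allRows k (P ∘ (true ∷_)) ∧ allRows k (P ∘ (false ∷_))

allExt : ∀ {k} r → Triangular k → (Triangular (r + k) → Bool) → Bool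
allExt zero    t P = P t
allExt (suc r) t P = allExt r t (λ t′ → allRows _ (λ row → P (row ∷ t′)))

allTri : ∀ k → (Triangular k → Bool) → Bool
allTri zero    P = P []
allTri (suc k) P = allTri k (λ t → allRows k (λ row → P (row ∷ t)))

final : ∀ r d → Triangular (r + d) → Bool
final r d t = not (Search.degree≥ (matrix t⁺) d) ∨ Search.search (matrix t⁺) (suc n) (n !) (allFin n) 1
  where
  n : ℕ
  n = suc (r + d)
  t⁺ : Triangular n
  t⁺ = (Vec.replicate r false Vec.++ Vec.replicate d true) ∷ t

-- H is the neighbourhood of a vertex of minimum degree d, which has r non-neighbours.
check : ℕ → ℕ → Bool
check r d = allTri d λ H → let open Search (matrix H) in
  not (degree≥ (d + d ∸ suc (r + d))) ∨ (maxUp d (allFin d) ≤ᵇ suc (r + d)) ∨ allExt r H (final r d)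

not-both : ∀ {b} → b ≡ true → not b ≢ true
not-both refl ()

∧-true : ∀ a {b} → a ∧ b ≡ true → a ≡ true × b ≡ true
∧-true true e = refl , e

∨-true : ∀ a {b} → a ∨ b ≡ true → a ≡ true ⊎ b ≡ true
∨-true true  e = inj₁ refl
∨-true false e = inj₂ e

T-true : ∀ {b} → b ≡ true → T b
T-true refl = tt

any-true : ∀ {A : Set} (p : A → Bool) xs → any p xs ≡ true → ∃ λ x → x ∈ˡ xs × p x ≡ true
any-true p (x ∷ xs) e with ∨-true (p x) e
... | inj₁ px = x , here refl , px
... | inj₂ e′ with y , y∈ , py ← any-true p xs e′ = y , there y∈ , py

allRows-sound : ∀ k {P} → allRows k P ≡ true → ∀ row → P row ≡ true
allRows-sound zero    e [] = e
allRows-sound (suc k) e (true  ∷ row) = allRows-sound k (proj₁ (∧-true (allRows k _) e)) row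
allRows-sound (suc k) e (false ∷ row) = allRows-sound k (proj₂ (∧-true (allRows k _) e)) row

allTri-sound : ∀ k {P} → allTri k P ≡ true → ∀ t → P t ≡ true
allTri-sound zero    e []        = e
allTri-sound (suc k) e (row ∷ t) = allRows-sound k (allTri-sound k e t) row

count-cong : ∀ {k} {P Q : Fin k → Bool} → (∀ i → P i ≡ Q i) → count P ≡ count Q
count-cong {zero}  e = refl
count-cong {suc k} e = cong₂ _+_ (cong bit (e zero)) (count-cong (e ∘ suc))

-- Enumerations of vertex sets

module _ {A : Set} where
  _▹_ : ∀ {k} → A → (Fin k → A) → Fin (suc k) → A
  (x ▹ f) zero    = x
  (x ▹ f) (suc i) = f i

  append : ∀ r {d} → (Fin r → A) → (Fin d → A) → Fin (r + d) → A
  append zero    f g = g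
  append (suc r) f g = f zero ▹ append r (f ∘ suc) g

  append-elim : ∀ {P : A → Set} r {d} {f : Fin r → A} {g : Fin d → A} →
    (∀ i → P (f i)) → (∀ i → P (g i)) → ∀ i → P (append r f g i)
  append-elim zero    p q i       = q i
  append-elim {P} (suc r) p q zero    = p zero
  append-elim {P} (suc r) p q (suc i) = append-elim {P} r (p ∘ suc) q i

  append-left : ∀ r {d} {f : Fin r → A} {g : Fin d → A} i → ∃ λ j → f i ≡ append r f g j
  append-left (suc r) zero = zero , refl
  append-left (suc r) {f = f} (suc i) with j , e ← append-left r {f = f ∘ suc} i = suc j , e

  append-right : ∀ r {d} {f : Fin r → A} {g : Fin d → A} i → ∃ λ j → g i ≡ append r f g j
  append-right zero i = i , refl
  append-right (suc r) {f = f} i with j , e ← append-right r {f = f ∘ suc} i = suc j , e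

  append-injective : ∀ r {d} {f : Fin r → A} {g : Fin d → A} →
    (∀ {i j} → f i ≡ f j → i ≡ j) → (∀ {i j} → g i ≡ g j → i ≡ j) → (∀ i j → f i ≢ g j) →
    ∀ {i j} → append r f g i ≡ append r f g j → i ≡ j
  append-injective zero fi gi dis e = gi e
  append-injective (suc r) fi gi dis {zero}  {zero}  e = refl
  append-injective (suc r) {f = f} fi gi dis {zero}  {suc j} e =
    ⊥-elim (append-elim {f zero ≢_} r (λ i e′ → Fin.0≢1+n (fi e′)) (dis zero) j e)
  append-injective (suc r) {f = f} fi gi dis {suc i} {zero}  e =
    ⊥-elim (append-elim {f zero ≢_} r (λ i e′ → Fin.0≢1+n (fi e′)) (dis zero) i (sym e))
  append-injective (suc r) fi gi dis {suc i} {suc j} e =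
    cong suc (append-injective r (Fin.suc-injective ∘ fi) gi (dis ∘ suc) e)

  count-append : ∀ r {d} (Q : A → Bool) (f : Fin r → A) (g : Fin d → A) →
    count (Q ∘ append r f g) ≡ count (Q ∘ f) + count (Q ∘ g)
  count-append zero    Q f g = refl
  count-append (suc r) Q f g = trans (cong (bit (Q (f zero)) +_) (count-append r Q (f ∘ suc) g))
    (sym (+-assoc (bit (Q (f zero))) _ _))

-- `counts` is what turns degrees in a graph into row sums of its matrix; each construction of an
-- enumeration maintains it.
record Enum {n} (P : Fin n → Bool) (k : ℕ) : Set where
  field
    at        : Fin k → Fin n
    at∈       : ∀ i → at i ∈ P
    onto      : ∀ {x} → x ∈ P → ∃ λ i → x ≡ at i
    injective : ∀ {i j} → at i ≡ at j → i ≡ j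
    counts    : ∀ Q → count (Q ∘ at) ≡ card (P ∩ Q)
open Enum

Enum-▹ : ∀ {n} {P : Fin n → Bool} {k x} → x ∈ P → Enum (P ∖ ⁅ x ⁆) k → Enum P (suc k)
Enum-▹ {P = P} {x = x} x∈P E = record
  { at        = x ▹ at E
  ; at∈       = λ { zero → x∈P ; (suc i) → ∖ˡ (at∈ E i) }
  ; onto      = onto′
  ; injective = injective′
  ; counts    = λ Q → trans (cong (bit (Q x) +_) (counts E Q)) (counts′ Q)
  }
  where
  injective′ : ∀ {i j} → (x ▹ at E) i ≡ (x ▹ at E) j → i ≡ j
  injective′ {zero}  {zero}  e = refl
  injective′ {zero}  {suc j} e = ⊥-elim (∖ʳ (at∈ E j) (subst (_∈ ⁅ x ⁆) e (∈⁅⁆ x)))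
  injective′ {suc i} {zero}  e = ⊥-elim (∖ʳ (at∈ E i) (subst (_∈ ⁅ x ⁆) (sym e) (∈⁅⁆ x)))
  injective′ {suc i} {suc j} e = cong suc (injective E e)

  onto′ : ∀ {y} → y ∈ P → ∃ λ i → y ≡ (x ▹ at E) i
  onto′ {y} p with y ∈? ⁅ x ⁆
  ... | yes e = zero , ⁅⁆⇒≡ e
  ... | no e with i , eq ← onto E (∈∖ p e) = suc i , eq

  counts′ : ∀ Q → bit (Q x) + card ((P ∖ ⁅ x ⁆) ∩ Q) ≡ card (P ∩ Q)
  counts′ Q with Q x in q
  ... | true  = sym (trans (card-remove (∈∩ x∈P (mem q))) (cong suc (card-cong
      (λ p → ∈∩ (∈∖ (∩ˡ (∖ˡ p)) (∖ʳ p)) (∩ʳ (∖ˡ p)))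
      (λ p → ∈∖ (∈∩ (∖ˡ (∩ˡ p)) (∩ʳ p)) (∖ʳ (∩ˡ p))))))
  ... | false = card-cong (λ p → ∈∩ (∖ˡ (∩ˡ p)) (∩ʳ p))
      (λ p → ∈∩ (∈∖ (∩ˡ p) λ e → false⇒∉ {P = Q} q (subst (_∈ Q) (⁅⁆⇒≡ e) (∩ʳ p))) (∩ʳ p))

Enum-append : ∀ {n} {P Q : Fin n → Bool} {r d} → Enum (P ∖ Q) r → Enum (P ∩ Q) d → Enum P (r + d)
Enum-append {P = P} {Q} {r} {d} E F = record
  { at        = append r (at E) (at F)
  ; at∈       = append-elim {P = _∈ P} r (∖ˡ ∘ at∈ E) (∩ˡ ∘ at∈ F)
  ; onto      = onto′
  ; injective = append-injective r (injective E) (injective F)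
                  (λ i j e → ∖ʳ (at∈ E i) (subst (_∈ Q) (sym e) (∩ʳ (at∈ F j))))
  ; counts    = λ R → trans (count-append r R (at E) (at F)) (trans (cong₂ _+_ (counts E R) (counts F R)) (counts′ R))
  }
  where
  onto′ : ∀ {x} → x ∈ P → ∃ λ i → x ≡ append r (at E) (at F) i
  onto′ {x} p with x ∈? Q
  ... | yes q with i , e ← onto F (∈∩ p q) with j , e′ ← append-right r {f = at E} {at F} i = j , trans e e′
  ... | no q  with i , e ← onto E (∈∖ p q) with j , e′ ← append-left r {f = at E} {at F} i = j , trans e e′

  counts′ : ∀ R → card ((P ∖ Q) ∩ R) + card ((P ∩ Q) ∩ R) ≡ card (P ∩ R)
  counts′ R = begin
    card ((P ∖ Q) ∩ R) + card ((P ∩ Q) ∩ R)  ≡⟨ +-comm (card ((P ∖ Q) ∩ R)) _ ⟩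
    card ((P ∩ Q) ∩ R) + card ((P ∖ Q) ∩ R)  ≡⟨ cong₂ _+_
      (card-cong (λ p → ∈∩ (∈∩ (∩ˡ (∩ˡ p)) (∩ʳ p)) (∩ʳ (∩ˡ p))) (λ p → ∈∩ (∈∩ (∩ˡ (∩ˡ p)) (∩ʳ p)) (∩ʳ (∩ˡ p))))
      (card-cong (λ p → ∈∖ (∈∩ (∖ˡ (∩ˡ p)) (∩ʳ p)) (∖ʳ (∩ˡ p))) (λ p → ∈∩ (∈∖ (∩ˡ (∖ˡ p)) (∖ʳ p)) (∩ʳ (∖ˡ p)))) ⟩
    card ((P ∩ R) ∩ Q) + card ((P ∩ R) ∖ Q)  ≡⟨ card-split (P ∩ R) Q ⟨
    card (P ∩ R)                             ∎
    where open ≡-Reasoning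

enum : ∀ k {n} (P : Fin n → Bool) → card P ≡ k → Enum P k
enum zero P c = record
  { at = λ () ; at∈ = λ () ; onto = λ p → ⊥-elim (none p) ; injective = λ { {()} }
  ; counts = λ Q → sym (card-empty (λ p → none (∩ˡ p))) }
  where
  none : ∀ {x} → x ∉ P
  none p with () ← subst (1 ≤_) c (member⇒card>0 p)
enum (suc k) P c with x , x∈P ← card>0⇒member {P = P} (subst (1 ≤_) (sym c) (s≤s z≤n)) =
  Enum-▹ x∈P (enum k (P ∖ ⁅ x ⁆) (suc-injective (trans (sym (card-remove x∈P)) c)))

-- Soundness of the search and the bound n!

module Small {n : ℕ} (G : Graph n) where
  open Orientations G

  Im : ∀ {k} → (Fin k → Fin n) → List (Fin k) → Fin n → Set
  Im f is y = ∃ λ i → i ∈ˡ is × y ≡ f i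

  code : ∀ {k} → (Fin k → Fin n) → Triangular k
  code {zero}  f = []
  code {suc k} f = Vec.tabulate (λ j → adj G (f zero) (f (suc j))) ∷ code (f ∘ suc)

  matrix-code : ∀ {k} (f : Fin k → Fin n) i j → matrix (code f) i j ≡ adj G (f i) (f j)
  matrix-code f zero    zero    = sym (adj-irr G (f zero))
  matrix-code f zero    (suc j) = Vec.lookup∘tabulate _ j
  matrix-code f (suc i) zero    = trans (Vec.lookup∘tabulate _ i) (adj-sym G (f zero) (f (suc i)))
  matrix-code f (suc i) (suc j) = matrix-code (f ∘ suc) i j

  allExt-sound : ∀ r {d P} (f : Fin r → Fin n) (g : Fin d → Fin n) →
    allExt r (code g) P ≡ true → P (code (append r f g)) ≡ true
  allExt-sound zero    f g e = e
  allExt-sound (suc r) {d} {P} f g e =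
    allRows-sound (r + d) {λ row → P (row ∷ code (append r (f ∘ suc) g))} (allExt-sound r (f ∘ suc) g e) _

  module _ {k : ℕ} (m : Fin k → Fin k → Bool) (f : Fin k → Fin n)
    (m≡adj : ∀ i j → m i j ≡ adj G (f i) (f j)) where
    open Search m

    -- `σ` itself selects the entry of `splits`: the direction of an edge at `x` decides in which
    -- branch its other end is forced.
    splits-sound : ∀ σ x ys → ∃₂ λ a b → (a , b) ∈ˡ splits x ys × length a ≤ length ys × length b ≤ length ys ×
      (∀ {i} → i ∈ˡ a → i ∈ˡ ys) × (∀ {i} → i ∈ˡ b → i ∈ˡ ys) ×
      (∀ {i} → i ∈ˡ ys → f i ∈ arc G σ (f x) ⊎ i ∈ˡ a) × (∀ {i} → i ∈ˡ ys → f x ∈ arc G σ (f i) ⊎ i ∈ˡ b)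
    splits-sound σ x [] = [] , [] , here refl , z≤n , z≤n , id , id , inj₂ , inj₂
    splits-sound σ x (y ∷ ys)
      with a , b , ab∈ , la , lb , a⊆ , b⊆ , out , inn ← splits-sound σ x ys with m x y in e
    ... | false = y ∷ a , y ∷ b , ∈-map⁺ _ ab∈ , s≤s la , s≤s lb , keep a⊆ , keep b⊆ , keep′ out , keep′ inn
      where
      keep : ∀ {zs} → (∀ {i} → i ∈ˡ zs → i ∈ˡ ys) → ∀ {i} → i ∈ˡ y ∷ zs → i ∈ˡ y ∷ ys
      keep s (here e)  = here e
      keep s (there p) = there (s p)
      keep′ : ∀ {Q : Fin k → Set} {zs} → (∀ {i} → i ∈ˡ ys → Q i ⊎ i ∈ˡ zs) → ∀ {i} → i ∈ˡ y ∷ ys → Q i ⊎ i ∈ˡ y ∷ zs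
      keep′ s (here e)  = inj₂ (here e)
      keep′ s (there p) = Sum.map₂ there (s p)
    ... | true with arc-oriented σ {f x} {f y} (mem (trans (sym (m≡adj x y)) e))
    ... | inj₁ x→y = a , y ∷ b , ∈-++⁺ʳ _ (∈-map⁺ _ ab∈) , ≤-trans la (n≤1+n _) , s≤s lb ,
      there ∘ a⊆ , (λ { (here e) → here e ; (there p) → there (b⊆ p) }) ,
      (λ { (here refl) → inj₁ x→y ; (there p) → out p }) ,
      (λ { (here e) → inj₂ (here e) ; (there p) → Sum.map₂ there (inn p) })
    ... | inj₂ y→x = y ∷ a , b , ∈-++⁺ˡ (∈-map⁺ _ ab∈) , s≤s la , ≤-trans lb (n≤1+n _) ,
      (λ { (here e) → here e ; (there p) → there (a⊆ p) }) , there ∘ b⊆ ,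
      (λ { (here e) → inj₂ (here e) ; (there p) → Sum.map₂ there (out p) }) ,
      (λ { (here refl) → inj₁ y→x ; (there p) → inn p })

    foldr-⊔ : ∀ {A : Set} (h : A → ℕ) {x} xs → x ∈ˡ xs → h x ≤ List.foldr (λ y r → h y ⊔ r) 0 xs
    foldr-⊔ h (x ∷ xs) (here refl) = m≤m⊔n (h x) _
    foldr-⊔ h (x ∷ xs) (there p)   = ≤-trans (foldr-⊔ h xs p) (m≤n⊔m (h x) _)

    maxUp-sound : ∀ σ l is → length is ≤ l → At.UCov σ (Im f is) (maxUp l is)
    maxUp-sound σ l       []       _        = At.UCov-none σ λ { (_ , () , _) }
    maxUp-sound σ (suc l) (x ∷ xs) (s≤s le)
      with a , b , ab∈ , la , lb , a⊆ , b⊆ , out , inn ← splits-sound σ x xs =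
      At.UCov-mono σ (foldr-⊔ (λ (a , b) → maxUp l a + maxUp l b) (splits x xs) ab∈)
        (At.UCov-branch σ (x , here refl , refl)
          (λ (i , i∈ , e) → i , there (a⊆ i∈) , e) (λ (i , i∈ , e) → i , there (b⊆ i∈) , e)
          (λ { (i , here refl , refl) → inj₁ refl
             ; (i , there p , refl) → inj₂ (Sum.map₂ (λ q → i , q , refl) (out p)) })
          (λ { (i , here refl , refl) → inj₁ refl
             ; (i , there p , refl) → inj₂ (Sum.map₂ (λ q → i , q , refl) (inn p)) })
          (maxUp-sound σ l a (≤-trans la le)) (maxUp-sound σ l b (≤-trans lb le)))

    degree≥-complete : ∀ d → (∀ i → d ≤ count (m i)) → degree≥ d ≡ true
    degree≥-complete d δ = go (allFin k)
      where
      go : ∀ is → List.foldr (λ i r → (d ≤ᵇ count (m i)) ∧ r) true is ≡ true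
      go []       = refl
      go (i ∷ is) = trans (cong (_∧ _) (Equivalence.to T-≡ (≤⇒≤ᵇ (δ i)))) (go is)

    -- Eliminating a vertex moves its factor from `acc` into `s`, so `s * acc` stays below `t`.
    -- `fewer` is the induction hypothesis for proper subsets.
    search-sound : (∀ {i j} → f i ≡ f j → i ≡ j) →
      (∀ vs → length vs < k → DCov (Im f vs) (length vs !)) →
      ∀ l t vs acc → search l t vs acc ≡ true → Σ ℕ λ s → DCov (Im f vs) s × s * acc ≤ t
    search-sound f-inj fewer (suc l) t vs acc e with ∨-true ((length vs <ᵇ k) ∧ ((length vs !) * acc ≤ᵇ t)) e
    ... | inj₁ e₁ with lt , le ← ∧-true (length vs <ᵇ k) e₁ =
      length vs ! , fewer vs (<ᵇ⇒< _ _ (T-true lt)) , ≤ᵇ⇒≤ _ _ (T-true le)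
    ... | inj₂ e₂ with v , v∈ , e₃ ← any-true _ vs e₂
      with _ , e₄ ← ∧-true (acc * maxUp (length (filterᵇ (m v) (without v vs))) (filterᵇ (m v) (without v vs)) ≤ᵇ t) e₃
      with s , D , le ← search-sound f-inj fewer l t (without v vs) _ e₄ =
      s * u , eliminate (v , v∈ , refl)
        (λ (i , i∈ , e) → i , proj₁ (∈-filter⁻ (T? ∘ _) i∈) , e)
        (λ { (i , i∈ , refl) e → distinct (proj₂ (∈-filter⁻ (T? ∘ _) {xs = vs} i∈)) (f-inj e) })
        split
        (λ (i , i∈ , e) → i , proj₁ (∈-filter⁻ (T? ∘ m v) i∈) , e)
        (λ { (i , i∈ , refl) → mem (trans (sym (m≡adj v i)) (Equivalence.to T-≡ (proj₂ (∈-filter⁻ (T? ∘ m v) {xs = without v vs} i∈)))) })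
        (λ { (i , i∈ , refl) (mem a) → i , ∈-filter⁺ (T? ∘ m v) i∈ (T-true (trans (m≡adj v i) a)) , refl })
        D (λ τ → maxUp-sound τ (length ns) ns ≤-refl) ,
      ≤-trans (≤-reflexive (trans (*-assoc s u acc) (cong (s *_) (*-comm u acc)))) le
      where
      ns : List (Fin k)
      ns = filterᵇ (m v) (without v vs)
      u : ℕ
      u = maxUp (length ns) ns
      distinct : ∀ {i} → T (not (does (i Fin.≟ v))) → i ≢ v
      distinct {i} p with i Fin.≟ v
      ... | no i≢v = i≢v
      split : ∀ {y} → Im f vs y → y ≡ f v ⊎ Im f (without v vs) y
      split (i , i∈ , refl) with i Fin.≟ v in eq
      ... | yes refl = inj₁ refl
      ... | no i≢v   = inj₂ (i , ∈-filter⁺ (T? ∘ _) i∈ (T-true (cong (not ∘ does) eq)) , refl)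

  members : ∀ {k} → (Fin k → Fin n) → List (Fin k) → Fin n → Bool
  members f vs y = does (Any.any? (λ i → y Fin.≟ f i) vs)

  ∈members : ∀ {k} {f : Fin k → Fin n} {vs y} → y ∈ members f vs → Im f vs y
  ∈members {f = f} {vs} {y} (mem e) with Any.any? (λ i → y Fin.≟ f i) vs
  ... | yes p = find p

  members∈ : ∀ {k} {f : Fin k → Fin n} {vs y} → Im f vs y → y ∈ members f vs
  members∈ {f = f} {vs} {y} (i , i∈ , e) = mem (dec-true (Any.any? (λ i → y Fin.≟ f i) vs) (lose i∈ e))

  card-members : ∀ {k} (f : Fin k → Fin n) vs → card (members f vs) ≤ length vs
  card-members f []       = ≤-reflexive (card-empty {P = members f []} λ { (mem ()) })
  card-members f (v ∷ vs) = ≤-trans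
    (card-cover {P = members f (v ∷ vs)} {⁅ f v ⁆} {members f vs} λ p → split (∈members p))
    (+-mono-≤ (≤-reflexive (card-⁅⁆ (f v))) (card-members f vs))
    where
    split : ∀ {y} → Im f (v ∷ vs) y → y ∈ ⁅ f v ⁆ ⊎ y ∈ members f vs
    split (i , here refl , refl) = inj₁ (∈⁅⁆ (f i))
    split (i , there p , e)      = inj₂ (members∈ (i , p , e))

  !-mono : ∀ {a b} → a ≤ b → a ! ≤ b !
  !-mono {b = b} z≤n = n≢0⇒n>0 (!-≢0 b)
    where
    !-≢0 : ∀ b → b ! ≢ 0
    !-≢0 b e = ≢-nonZero⁻¹ (b !) {{b !≢0}} e
  !-mono (s≤s le) = *-mono-≤ (s≤s le) (!-mono le)

  -- Every neighbour w of v misses at most card S - deg v vertices outside N(v).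
  common-degree : ∀ S v w → card (S ∩ adj G w) + card (S ∩ adj G v) ≤ card ((S ∩ adj G v) ∩ adj G w) + card S
  common-degree S v w = begin
    card (S ∩ adj G w) + dᵥ                              ≤⟨ +-monoˡ-≤ dᵥ (card-cover {Q = N ∩ adj G w} {S ∖ adj G v} split) ⟩
    card (N ∩ adj G w) + card (S ∖ adj G v) + dᵥ         ≡⟨ +-assoc (card (N ∩ adj G w)) _ _ ⟩
    card (N ∩ adj G w) + (card (S ∖ adj G v) + dᵥ)       ≡⟨ cong (card (N ∩ adj G w) +_)
      (trans (+-comm _ dᵥ) (sym (card-split S (adj G v)))) ⟩
    card (N ∩ adj G w) + card S                          ∎
    where
    open ≤-Reasoning
    N : Fin n → Bool
    N = S ∩ adj G v
    dᵥ : ℕ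
    dᵥ = card N
    split : ∀ {y} → y ∈ S ∩ adj G w → y ∈ N ∩ adj G w ⊎ y ∈ S ∖ adj G v
    split {y} p with y ∈? adj G v
    ... | yes q = inj₁ (∈∩ (∈∩ (∩ˡ p) q) (∩ʳ p))
    ... | no q  = inj₂ (∈∖ (∩ˡ p) q)

  degree<card : ∀ {S v} → v ∈ S → card (S ∩ adj G v) < card S
  degree<card {S} {v} v∈S = subst (suc (card (S ∩ adj G v)) ≤_) (sym (card-remove v∈S))
    (s≤s (card-mono λ p → ∈∖ (∩ˡ p) λ e → adj⇒≢ (∩ʳ p) (sym (⁅⁆⇒≡ e))))

  row-shape : ∀ r {d} {Q : Fin n → Bool} {f : Fin r → Fin n} {g : Fin d → Fin n} →
    (∀ i → Q (f i) ≡ false) → (∀ i → Q (g i) ≡ true) →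
    Vec.tabulate (Q ∘ append r f g) ≡ Vec.replicate r false Vec.++ Vec.replicate d true
  row-shape zero {zero}  p q = refl
  row-shape zero {suc d} {Q} {f} {g} p q = cong₂ _∷_ (q zero) (row-shape zero {d} {Q} {f} {g ∘ suc} p (q ∘ suc))
  row-shape (suc r) {d} {Q} {f} {g} p q = cong₂ _∷_ (p zero) (row-shape r {d} {Q} {f ∘ suc} {g} (p ∘ suc) q)

  fact-suc : ∀ k → k ! * suc k ≡ suc k !
  fact-suc k = *-comm (k !) (suc k)

  module _ {S : Fin n → Bool} {v : Fin n} (v∈S : v ∈ S) (r d : ℕ)
    (S≡n : card S ≡ suc (r + d)) (deg≡d : card (S ∩ adj G v) ≡ d)
    (min : ∀ {w} → w ∈ S → d ≤ card (S ∩ adj G w))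
    (fewer : ∀ S′ → card S′ < card S → DCov (_∈ S′) (card S′ !)) where

    private
      m : ℕ
      m = suc (r + d)

      N : Fin n → Bool
      N = (S ∖ ⁅ v ⁆) ∩ adj G v

      ≢v : ∀ {y} → y ∈ adj G v → y ∉ ⁅ v ⁆
      ≢v p e = adj⇒≢ p (sym (⁅⁆⇒≡ e))

      cardN : card N ≡ d
      cardN = trans (card-cong (λ p → ∈∩ (∖ˡ (∩ˡ p)) (∩ʳ p)) (λ p → ∈∩ (∈∖ (∩ˡ p) (≢v (∩ʳ p))) (∩ʳ p))) deg≡d

      cardR : card ((S ∖ ⁅ v ⁆) ∖ adj G v) ≡ r
      cardR = +-cancelʳ-≡ d _ r (begin
        card ((S ∖ ⁅ v ⁆) ∖ adj G v) + d        ≡⟨ cong (card ((S ∖ ⁅ v ⁆) ∖ adj G v) +_) cardN ⟨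
        card ((S ∖ ⁅ v ⁆) ∖ adj G v) + card N   ≡⟨ +-comm _ (card N) ⟩
        card N + card ((S ∖ ⁅ v ⁆) ∖ adj G v)   ≡⟨ card-split (S ∖ ⁅ v ⁆) (adj G v) ⟨
        card (S ∖ ⁅ v ⁆)                        ≡⟨ suc-injective (trans (sym (card-remove v∈S)) S≡n) ⟩
        r + d                                   ∎)
        where open ≡-Reasoning

      ER : Enum ((S ∖ ⁅ v ⁆) ∖ adj G v) r
      ER = enum r _ cardR

      EN : Enum N d
      EN = enum d N cardN

      -- The order `v`, non-neighbours, neighbours is the one that `final` presupposes; it gives the
      -- first row the form in `shape`.
      E : Enum S m
      E = Enum-▹ v∈S (Enum-append ER EN)

      f : Fin m → Fin n
      f = at E

      g : Fin d → Fin n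
      g = at EN

      shape : code f ≡ (Vec.replicate r false Vec.++ Vec.replicate d true) ∷ code (append r (at ER) g)
      shape = cong (_∷ code (append r (at ER) g))
        (row-shape r {d} {adj G v} {at ER} {g} (λ i → ∉⇒false {P = adj G v} (∖ʳ (at∈ ER i))) (λ i → holds (∩ʳ (at∈ EN i))))

      denseN : Search.degree≥ (matrix (code g)) (d + d ∸ m) ≡ true
      denseN = degree≥-complete (matrix (code g)) g (matrix-code g) (d + d ∸ m) λ i → begin
        d + d ∸ m                               ≤⟨ m≤n+o⇒m∸n≤o (d + d) m (subst₂ _≤_ (cong (d +_) deg≡d)
          (trans (cong (card ((S ∩ adj G v) ∩ adj G (g i)) +_) S≡n) (+-comm _ m))
          (≤-trans (+-monoˡ-≤ _ (min (∖ˡ (∩ˡ (at∈ EN i))))) (common-degree S v (g i)))) ⟩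
        card ((S ∩ adj G v) ∩ adj G (g i))      ≤⟨ card-mono (λ p → ∈∩ (∈∩ (∈∖ (∩ˡ (∩ˡ p)) (≢v (∩ʳ (∩ˡ p)))) (∩ʳ (∩ˡ p))) (∩ʳ p)) ⟩
        card (N ∩ adj G (g i))                  ≡⟨ counts EN (adj G (g i)) ⟨
        count (adj G (g i) ∘ g)                 ≡⟨ count-cong (λ j → sym (matrix-code g i j)) ⟩
        count (matrix (code g) i)               ∎
        where open ≤-Reasoning

      denseS : Search.degree≥ (matrix (code f)) d ≡ true
      denseS = degree≥-complete (matrix (code f)) f (matrix-code f) d λ i → begin
        d                                       ≤⟨ min (at∈ E i) ⟩
        card (S ∩ adj G (f i))                  ≡⟨ counts E (adj G (f i)) ⟨
        count (adj G (f i) ∘ f)                 ≡⟨ count-cong (λ j → sym (matrix-code f i j)) ⟩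
        count (matrix (code f) i)               ∎
        where open ≤-Reasoning

      fewer′ : ∀ vs → length vs < m → DCov (Im f vs) (length vs !)
      fewer′ vs lt = DCov-mono (!-mono (card-members f vs)) (DCov-resp ∈members members∈
        (fewer (members f vs) (subst (card (members f vs) <_) (sym S≡n) (≤-<-trans (card-members f vs) lt))))

      Im-all : ∀ {k} {P : Fin n → Bool} (F : Enum P k) {y} → y ∈ P → Im (at F) (allFin k) y
      Im-all F p with i , e ← onto F p = i , ∈-allFin i , e

      Im-all⁻ : ∀ {k} {P : Fin n → Bool} (F : Enum P k) {y} → Im (at F) (allFin k) y → y ∈ P
      Im-all⁻ F (i , _ , refl) = at∈ F i

      fewer-v : DCov (_∈ S ∖ ⁅ v ⁆) ((r + d) !)
      fewer-v = subst (λ k → DCov (_∈ S ∖ ⁅ v ⁆) (k !)) (suc-injective (trans (sym (card-remove v∈S)) S≡n))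
        (fewer (S ∖ ⁅ v ⁆) (≤-reflexive (sym (card-remove v∈S))))

    -- Each alternative in `check` is impossible or sufficient. Minimality of `d` gives every
    -- neighbour of `v` at least 2d - m neighbours inside `N`, so the skipped neighbourhoods do not
    -- occur. If `N` has at most `m` closed sets, deleting `v` costs just the factor from (m - 1)!
    -- to m!. Otherwise the whole graph has been searched.
    check-sound : check r d ≡ true → DCov (_∈ S) (m !)
    check-sound e = [ (λ e₁ → ⊥-elim (not-both denseN e₁)) ,
      [ quick , searched ]′ ∘ ∨-true (Search.maxUp (matrix (code g)) d (allFin d) ≤ᵇ m) ]′
      (∨-true (not (Search.degree≥ (matrix (code g)) (d + d ∸ m))) (allTri-sound d e (code g)))
      where
      quick : (Search.maxUp (matrix (code g)) d (allFin d) ≤ᵇ m) ≡ true → DCov (_∈ S) (m !)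
      quick e₃ = subst (DCov (_∈ S)) (fact-suc (r + d))
        (eliminate v∈S ∖ˡ ∖-≢ ∖-split (λ p → ∩ˡ (Im-all⁻ EN p)) (λ p → ∩ʳ (Im-all⁻ EN p))
          (λ p q → Im-all EN (∈∩ p q)) fewer-v
          (λ τ → At.UCov-mono τ (≤ᵇ⇒≤ _ _ (T-true e₃))
            (maxUp-sound (matrix (code g)) g (matrix-code g) τ d (allFin d) (≤-reflexive (length-tabulate id)))))

      found : Search.search (matrix (code f)) (suc m) (m !) (allFin m) 1 ≡ true → DCov (_∈ S) (m !)
      found e₅ = let s , D , le = search-sound (matrix (code f)) f (matrix-code f) (injective E) fewer′ (suc m) (m !) (allFin m) 1 e₅
        in DCov-resp (Im-all⁻ E) (Im-all E) (DCov-mono (subst (_≤ m !) (*-identityʳ s) le) D)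

      searched : allExt r (code g) (final r d) ≡ true → DCov (_∈ S) (m !)
      searched e₃ = [ (λ e₅ → ⊥-elim (not-both denseS e₅)) , found ]′
        (∨-true (not (Search.degree≥ (matrix (code f)) d))
          (subst (λ t → not (Search.degree≥ (matrix t) d) ∨ Search.search (matrix t) (suc m) (m !) (allFin m) 1 ≡ true)
            (sym shape) (allExt-sound r (at ER) g e₃)))

  -- `sparse` lets all subsets of the neighbourhood count. In the case `complete` the vertex of
  -- minimum degree has no non-neighbours, so the graph is complete and `minDeg-bound` yields
  -- exactly `d + 1`, the number of vertices.
  data Case (r d : ℕ) : Set where
    sparse   : 2 ^ d ≤ suc (r + d) → Case r d
    complete : r ≡ 0 → Case r d
    checked  : check r d ≡ true → Case r d

  -- For `d ≤ 2` all 2^d subsets are affordable. With non-neighbours present and `d ≥ 3`, six pairs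
  -- remain; each `refl` makes the type checker run the exhaustive `check`.
  cases : ∀ r d → r + d ≤ 6 → Case r d
  cases 0 d _ = complete refl
  cases (suc r) 0 _ = sparse (s≤s z≤n)
  cases (suc r) 1 _ = sparse (s≤s (s≤s z≤n))
  cases (suc r) 2 _ = sparse (s≤s (s≤s (m≤n+m 2 r)))
  cases 1 3 _ = checked refl
  cases 2 3 _ = checked refl
  cases 3 3 _ = checked refl
  cases (suc (suc (suc (suc r)))) 3 le = ⊥-elim (<⇒≱ (s≤s (s≤s (s≤s (s≤s (m≤n+m 3 r))))) le)
  cases 1 4 _ = checked refl
  cases 2 4 _ = checked refl
  cases (suc (suc (suc r))) 4 le = ⊥-elim (<⇒≱ (s≤s (s≤s (s≤s (m≤n+m 4 r)))) le)
  cases 1 5 _ = checked refl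
  cases (suc (suc r)) 5 le = ⊥-elim (<⇒≱ (s≤s (s≤s (m≤n+m 5 r))) le)
  cases (suc r) (suc (suc (suc (suc (suc (suc d)))))) le =
    ⊥-elim (<⇒≱ (s≤s (≤-trans (m≤m+n 6 d) (m≤n+m (6 + d) r))) le)

  -- Attained by complete graphs, whose admissible orientations are the linear orders of the
  -- vertices.
  small : ∀ S → card S ≤ 7 → DCov (_∈ S) (card S !)
  small S = go (card S) S ≤-refl
    where
    go : ∀ b S → card S ≤ b → card S ≤ 7 → DCov (_∈ S) (card S !)
    go b S c≤b c≤7 with 1 ≤? card S
    ... | no c<1 = DCov-mono (1≤n! (card S)) (DCov-none λ p → c<1 (member⇒card>0 p))
    go zero    S c≤b c≤7 | yes 1≤c with () ← ≤-trans 1≤c c≤b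
    go (suc b) S c≤b c≤7 | yes 1≤c with v , v∈S , min ← min-degree S 1≤c = result (cases r d r+d≤6)
      where
      d r : ℕ
      d = card (S ∩ adj G v)
      r = card S ∸ suc d
      S≡ : card S ≡ suc (r + d)
      S≡ = sym (trans (sym (+-suc r d)) (m∸n+n≡m (degree<card v∈S)))
      r+d≤6 : r + d ≤ 6
      r+d≤6 = ≤-pred (subst (_≤ 7) S≡ c≤7)
      fewer : ∀ S′ → card S′ < card S → DCov (_∈ S′) (card S′ !)
      fewer S′ lt = go b S′ (≤-pred (≤-trans lt c≤b)) (≤-trans (<⇒≤ lt) c≤7)
      fewer-v : DCov (_∈ S ∖ ⁅ v ⁆) ((r + d) !)
      fewer-v = subst (λ k → DCov (_∈ S ∖ ⁅ v ⁆) (k !)) (suc-injective (trans (sym (card-remove v∈S)) S≡))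
        (fewer (S ∖ ⁅ v ⁆) (≤-reflexive (sym (card-remove v∈S))))
      product : ∀ {a b} → (∀ τ → At.Bd τ (S ∩ adj G v) d a b) → a * 2 ^ d ≤ suc (r + d) * 2 ^ b → DCov (_∈ S) (card S !)
      product B le = subst (DCov (_∈ S)) (trans (fact-suc (r + d)) (cong _! (sym S≡)))
        (eliminate-Bd (suc (r + d)) v∈S fewer-v B le)
      result : Case r d → DCov (_∈ S) (card S !)
      result (sparse le) = product (λ τ → At.Bd-full τ 0 (≤-reflexive (+-identityʳ d)))
        (subst₂ _≤_ (sym (+-identityʳ (2 ^ d))) (sym (*-identityʳ _)) le)
      result (checked e) = subst (λ k → DCov (_∈ S) (k !)) (sym S≡) (check-sound v∈S r d S≡ refl min fewer e)
      result (complete r≡0) with 1 ≤? d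
      ... | no d<1 = product (λ τ → At.Bd-full τ 0 (≤-reflexive (+-identityʳ d)))
        (subst (λ k → 1 * 2 ^ k ≤ suc (r + d) * 1) (sym (n<1⇒n≡0 (≰⇒> d<1))) (s≤s z≤n))
      ... | yes 1≤d = product (λ τ → At.minDeg-bound τ (d ∸ 1) 1≤d dense) (≤-reflexive (begin
        (2 + (d ∸ 1)) * 2 ^ d               ≡⟨ cong (λ k → suc k * 2 ^ d) (m+[n∸m]≡n 1≤d) ⟩
        suc d * 2 ^ d                       ≡⟨ cong₂ (λ k l → suc (k + d) * 2 ^ l) (sym r≡0) (sym (m+[n∸m]≡n 1≤d)) ⟩
        suc (r + d) * 2 ^ suc (d ∸ 1)       ∎))
        where
        open ≡-Reasoning
        dense : ∀ {w} → w ∈ S ∩ adj G v → d ∸ 1 ≤ card ((S ∩ adj G v) ∩ adj G w)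
        dense {w} p = m≤n+o⇒m∸n≤o d 1 (+-cancelʳ-≤ d d _ (≤-trans (+-monoˡ-≤ d (min (∩ˡ p)))
          (≤-trans (common-degree S v w) (≤-reflexive (trans (cong (c +_) (trans S≡ (cong (λ k → suc (k + d)) r≡0))) (+-suc c d))))))
          where
          c : ℕ
          c = card ((S ∩ adj G v) ∩ adj G w)

-- Induction on the number of vertices

<-ratio : ∀ k M → k * 17 < 16 * M → k < M
<-ratio k M lt = *-cancelʳ-< 17 k M
  (<-≤-trans lt (≤-trans (*-monoˡ-≤ M (≤ᵇ⇒≤ 16 17 tt)) (≤-reflexive (*-comm 17 M))))

module Induction {n : ℕ} (G : Graph n) where
  open Orientations G
  open Small G

  record Bipartition (S : Fin n → Bool) (a : ℕ) : Set where
    field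
      side   : Fin n → Bool
      size   : card (S ∩ side) ≡ a
      cross  : ∀ {x y} → x ∈ S → y ∈ S → x ∈ side → y ∉ side → y ∈ adj G x
      inner  : ∀ {x y} → x ∈ S → y ∈ S → x ∈ side → y ∈ side → y ∉ adj G x
      outer  : ∀ {x y} → x ∈ S → y ∈ S → x ∉ side → y ∉ side → y ∉ adj G x

  module _ {S : Fin n → Bool} {a b : ℕ} (S≡ : card S ≡ a + b) (B : Bipartition S a) where
    open Bipartition B

    other-size : card (S ∖ side) ≡ b
    other-size = +-cancelˡ-≡ a _ b (trans (cong (_+ card (S ∖ side)) (sym size)) (trans (sym (card-split S side)) S≡))

    opposite : Bipartition S b
    opposite = record
      { side  = S ∖ side
      ; size  = trans (card-cong ∩ʳ (λ p → ∈∩ (∖ˡ p) p)) other-size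
      ; cross = λ xS yS x y → adj-symm (cross yS xS (back yS y) (∖ʳ x))
      ; inner = λ xS yS x y → outer xS yS (∖ʳ x) (∖ʳ y)
      ; outer = λ xS yS x y → inner xS yS (back xS x) (back yS y)
      }
      where
      back : ∀ {x} → x ∈ S → x ∉ S ∖ side → x ∈ side
      back {x} xS x∉ with x ∈? side
      ... | yes p = p
      ... | no p  = ⊥-elim (x∉ (∈∖ xS p))

    bipartition-degree : ∀ {w} → w ∈ S → card (S ∩ adj G w) ≡ a ⊎ card (S ∩ adj G w) ≡ b
    bipartition-degree {w} wS with w ∈? side
    ... | yes p = inj₂ (trans (card-cong
      (λ q → ∈∖ (∩ˡ q) (λ s → inner wS (∩ˡ q) p s (∩ʳ q)))
      (λ q → ∈∩ (∖ˡ q) (cross wS (∖ˡ q) p (∖ʳ q)))) other-size)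
    ... | no p = inj₁ (trans (card-cong to
      (λ q → ∈∩ (∩ˡ q) (adj-symm (cross (∩ˡ q) wS (∩ʳ q) p)))) size)
      where
      to : (S ∩ adj G w) ⊆ (S ∩ side)
      to {y} q with y ∈? side
      ... | yes s = ∈∩ (∩ˡ q) s
      ... | no s  = ⊥-elim (outer wS (∩ˡ q) p s (∩ʳ q))

  -- The `a` vertices of one side are deleted in turn, each having at most `b` neighbours.
  bipartite-DCov : ∀ a b {S A : Fin n → Bool} → card (S ∩ A) ≡ a → card (S ∖ A) ≤ b →
    (∀ {x y} → x ∈ S → y ∈ S → x ∈ A → y ∈ A → y ∉ adj G x) →
    (∀ {x y} → x ∈ S → y ∈ S → x ∉ A → y ∉ A → y ∉ adj G x) → DCov (_∈ S) (2 ^ (a * b))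
  bipartite-DCov zero b {S} {A} ca cb inner outer =
    (λ _ _ → false) ∷ [] , ≤-refl , λ σ _ → here (agreeing λ p q →
      trans (arc-false σ (outer p q (none p) (none q))) (sym (arc-false (λ _ _ → false) (outer p q (none p) (none q)))))
    where
    none : ∀ {x} → x ∈ S → x ∉ A
    none p q with () ← subst (1 ≤_) ca (member⇒card>0 (∈∩ p q))
  bipartite-DCov (suc a) b {S} {A} ca cb inner outer
    with v , v∈ ← card>0⇒member {P = S ∩ A} (subst (1 ≤_) (sym ca) (s≤s z≤n)) =
    subst (DCov (_∈ S)) (trans (sym (^-distribˡ-+-* 2 (a * b) b)) (cong (2 ^_) (+-comm (a * b) b)))
      (eliminate-Bd (2 ^ b) (∩ˡ v∈)
        (bipartite-DCov a b ca′ cb′ (λ p q → inner (∖ˡ p) (∖ˡ q)) (λ p q → outer (∖ˡ p) (∖ˡ q)))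
        (λ τ → At.Bd-full τ 0 (≤-reflexive (+-identityʳ _)))
        (≤-trans (≤-reflexive (*-identityˡ _)) (≤-trans (^-monoʳ-≤ 2 nbhd) (≤-reflexive (sym (*-identityʳ _))))))
    where
    ca′ : card ((S ∖ ⁅ v ⁆) ∩ A) ≡ a
    ca′ = suc-injective (trans (cong suc (card-cong
      (λ p → ∈∖ (∈∩ (∖ˡ (∩ˡ p)) (∩ʳ p)) (∖ʳ (∩ˡ p)))
      (λ p → ∈∩ (∈∖ (∩ˡ (∖ˡ p)) (∖ʳ p)) (∩ʳ (∖ˡ p))))) (trans (sym (card-remove v∈)) ca))
    cb′ : card ((S ∖ ⁅ v ⁆) ∖ A) ≤ b
    cb′ = ≤-trans (card-mono (λ p → ∈∖ (∖ˡ (∖ˡ p)) (∖ʳ p))) cb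
    nbhd : card (S ∩ adj G v) ≤ b
    nbhd = ≤-trans (card-mono (λ p → ∈∖ (∩ˡ p) (λ q → inner (∩ˡ v∈) (∩ˡ p) (∩ʳ v∈) q (∩ʳ p)))) cb

  Bipartition-DCov : ∀ {S a b} → card S ≡ a + b → Bipartition S a → DCov (_∈ S) (2 ^ (a * b))
  Bipartition-DCov {a = a} {b} S≡ B = bipartite-DCov a b size (≤-reflexive (other-size S≡ B)) inner outer
    where open Bipartition B

  module MinVertex {S : Fin n → Bool} {v : Fin n} (v∈S : v ∈ S)
    (min : ∀ {w} → w ∈ S → card (S ∩ adj G v) ≤ card (S ∩ adj G w)) where

    N : Fin n → Bool
    N = S ∩ adj G v

    nbhd-minDeg : ∀ e {w} → e + card S ≤ card N + card N → w ∈ N → e ≤ card (N ∩ adj G w)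
    nbhd-minDeg e {w} le p = +-cancelʳ-≤ (card S) e _
      (≤-trans le (≤-trans (+-monoˡ-≤ (card N) (min (∩ˡ p))) (common-degree S v w)))

    free-DCov : ∀ {k} e → card N ≤ e → DCov (_∈ S ∖ ⁅ v ⁆) k → DCov (_∈ S) (k * 2 ^ e)
    free-DCov e le D = eliminate-Bd (2 ^ e) v∈S D (λ τ → At.Bd-full τ 0 (≤-reflexive (+-identityʳ _)))
      (≤-trans (≤-reflexive (*-identityˡ _)) (≤-trans (^-monoʳ-≤ 2 le) (≤-reflexive (sym (*-identityʳ _)))))

  Edge : (Fin n → Bool) → Set
  Edge P = ∃ λ x → x ∈ P × ∃ λ y → y ∈ P × y ∈ adj G x

  edge? : ∀ P → Dec (Edge P)
  edge? P = any? (λ x → (x ∈? P) ×-dec any? (λ y → (y ∈? P) ×-dec (y ∈? adj G x)))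

  edge-DCov : ∀ {S v k} g → v ∈ S → card (S ∩ adj G v) ≡ 2 + g → Edge (S ∩ adj G v) →
    DCov (_∈ S ∖ ⁅ v ⁆) k → DCov (_∈ S) (k * (3 * 2 ^ g))
  edge-DCov {S} {v} g v∈S deg (x , x∈ , y , y∈ , xy) D =
    eliminate-Bd (3 * 2 ^ g) v∈S D (λ τ → At.edge τ x∈ y∈ xy)
      (≤-reflexive (trans (cong (λ d → 3 * 2 ^ d) deg) (arith (2 ^ g))))
    where
    arith : ∀ p → 3 * (2 * (2 * p)) ≡ 3 * p * 4
    arith = solve-∀

  -- What the general bound on closed sets requires in `even-step` when the minimum degree is
  -- `k + 2` above half. At `k = 0` it is an equality, so the factor 3/4 has no slack there.
  linear≤exp : ∀ k → 4 * (3 + k) ≤ 3 * 2 ^ (2 + k)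
  linear≤exp zero    = ≤ᵇ⇒≤ _ _ tt
  linear≤exp (suc k) = begin
    4 * (3 + suc k)              ≡⟨ arith₁ k ⟩
    4 * (3 + k) + 4              ≤⟨ +-monoʳ-≤ (4 * (3 + k)) (≤-trans (m≤m*n 4 (3 + k)) ≤-refl) ⟩
    4 * (3 + k) + 4 * (3 + k)    ≤⟨ +-mono-≤ (linear≤exp k) (linear≤exp k) ⟩
    3 * 2 ^ (2 + k) + 3 * 2 ^ (2 + k) ≡⟨ arith₂ (2 ^ (2 + k)) ⟩
    3 * 2 ^ (3 + k)              ∎
    where
    open ≤-Reasoning
    arith₁ : ∀ k → 4 * (3 + suc k) ≡ 4 * (3 + k) + 4
    arith₁ = solve-∀
    arith₂ : ∀ p → 3 * p + 3 * p ≡ 3 * (2 * p)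
    arith₂ = solve-∀

  -- The counterpart for `odd-step` with excess `j + 3`, where the factor aimed at is 7/8.
  linear≤exp′ : ∀ j → 7 + 2 * j ≤ 7 * 2 ^ j
  linear≤exp′ zero    = ≤-refl
  linear≤exp′ (suc j) = begin
    7 + 2 * suc j                    ≡⟨ arith₁ j ⟩
    2 + (7 + 2 * j)                  ≤⟨ +-mono-≤ {2} {7 * 2 ^ j} (≤-trans (≤ᵇ⇒≤ 2 7 tt) (m≤m*n 7 (2 ^ j) {{m^n≢0 2 j}})) (linear≤exp′ j) ⟩
    7 * 2 ^ j + 7 * 2 ^ j            ≡⟨ arith₂ (2 ^ j) ⟩
    7 * 2 ^ suc j                    ∎
    where
    open ≤-Reasoning
    arith₁ : ∀ j → 7 + 2 * suc j ≡ 2 + (7 + 2 * j)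
    arith₁ = solve-∀
    arith₂ : ∀ p → 7 * p + 7 * p ≡ 7 * (2 * p)
    arith₂ = solve-∀

  -- With h = `4 + g`, the target is 3/4 · 2^h. Minimum degree below h gives 1/2; an edge in a
  -- neighbourhood of size h gives 3/4; excess 1 gives 2 · 3/8. If the neighbourhood is independent,
  -- either the graph is complete bipartite or another vertex is the better one to delete.
  even-step : ∀ g {S M} → card S ≡ (4 + g) + (4 + g) → (∀ {v} → v ∈ S → DCov (_∈ S ∖ ⁅ v ⁆) M) →
    Bipartition S (4 + g) ⊎ DCov (_∈ S) (M * (3 * 2 ^ (2 + g)))
  even-step g {S} {M} S≡ fewer
    with v , v∈S , min ← min-degree S (subst (1 ≤_) (sym S≡) (s≤s z≤n)) = by-degree (<-cmp (card N) (4 + g))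
    where
    open MinVertex v∈S min

    Result : Set
    Result = Bipartition S (4 + g) ⊎ DCov (_∈ S) (M * (3 * 2 ^ (2 + g)))

    rest≡ : card N ≡ 4 + g → card (S ∖ adj G v) ≡ 4 + g
    rest≡ d≡ = +-cancelˡ-≡ (4 + g) _ _
      (trans (cong (_+ card (S ∖ adj G v)) (sym d≡)) (trans (sym (card-split S (adj G v))) S≡))

    module _ (d≡ : card N ≡ 4 + g) (indep : ¬ Edge N) {w : Fin n} (w∈N : w ∈ N) where
      nbhd⊆rest : (S ∩ adj G w) ⊆ (S ∖ adj G v)
      nbhd⊆rest q = ∈∖ (∩ˡ q) (λ r → indep (w , w∈N , _ , ∈∩ (∩ˡ q) r , ∩ʳ q))

      -- `w` has no neighbour in `N` but degree at least `4 + g`, the number of vertices outside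
      -- `N`; so it is joined to all of them.
      rest⊆nbhd : (S ∖ adj G v) ⊆ (S ∩ adj G w)
      rest⊆nbhd = ⊆-card-≥⇒⊇ nbhd⊆rest (≤-trans (≤-reflexive (trans (rest≡ d≡) (sym d≡))) (min (∩ˡ w∈N)))

    independent : card N ≡ 4 + g → ¬ Edge N → Result
    independent d≡ indep with edge? (S ∖ adj G v)
    ... | no indep′ = inj₁ record
      { side  = adj G v
      ; size  = d≡
      ; cross = λ xS yS x y → ∩ʳ (rest⊆nbhd d≡ indep (∈∩ xS x) (∈∖ yS y))
      ; inner = λ xS yS x y xy → indep (_ , ∈∩ xS x , _ , ∈∩ yS y , xy)
      ; outer = λ xS yS x y xy → indep′ (_ , ∈∖ xS x , _ , ∈∖ yS y , xy)
      }
    -- `w` is deleted in place of `v`: its neighbourhood is the complement of `N`, and that one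
    -- contains an edge.
    ... | yes (x , x∈ , y , y∈ , xy) with w , w∈N ← card>0⇒member {P = N} (subst (1 ≤_) (sym d≡) (s≤s z≤n)) =
      inj₂ (edge-DCov (2 + g) (∩ˡ w∈N) (trans (card-cong (nbhd⊆rest d≡ indep w∈N) rest⊆) (rest≡ d≡))
        (x , rest⊆ x∈ , y , rest⊆ y∈ , xy) (fewer (∩ˡ w∈N)))
      where
      rest⊆ : (S ∖ adj G v) ⊆ (S ∩ adj G w)
      rest⊆ = rest⊆nbhd d≡ indep w∈N

    large : ∀ k → card N ≡ suc k + (4 + g) → Result
    large zero d≡ = inj₂ (eliminate-Bd (3 * 2 ^ (2 + g)) v∈S (fewer v∈S)
      (λ τ → At.minDeg₂-5 τ (λ p → nbhd-minDeg 2 (≤-reflexive (trans (cong (2 +_) S≡) (trans (arith₁ g) (cong₂ _+_ (sym d≡) (sym d≡))))) p)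
        (subst (5 ≤_) (sym d≡) (s≤s (m≤m+n 4 g))))
      (≤-reflexive (trans (cong (λ d → 3 * 2 ^ d) d≡) (arith₂ (2 ^ g)))))
      where
      arith₁ : ∀ g → 2 + ((4 + g) + (4 + g)) ≡ (5 + g) + (5 + g)
      arith₁ = solve-∀
      arith₂ : ∀ p → 3 * (2 * (2 * (2 * (2 * (2 * p))))) ≡ 3 * (2 * (2 * p)) * 8
      arith₂ = solve-∀
    large (suc k) d≡ = inj₂ (eliminate-Bd (3 * 2 ^ (2 + g)) v∈S (fewer v∈S)
      (λ τ → At.minDeg-bound τ (4 + (k + k)) (subst (1 ≤_) (sym d≡) (s≤s z≤n))
        (nbhd-minDeg (4 + (k + k)) (≤-reflexive (trans (cong (4 + (k + k) +_) S≡) (trans (arith₁ k g) (cong₂ _+_ (sym d≡) (sym d≡)))))))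
      (begin
        (6 + (k + k)) * 2 ^ card N                       ≡⟨ cong (λ d → (6 + (k + k)) * 2 ^ d) (trans d≡ (arith₂ k g)) ⟩
        (6 + (k + k)) * 2 ^ (k + (6 + g))                ≡⟨ cong ((6 + (k + k)) *_) (^-distribˡ-+-* 2 k (6 + g)) ⟩
        (6 + (k + k)) * (2 ^ k * 2 ^ (6 + g))            ≡⟨ arith₃ k (2 ^ k) (2 ^ g) ⟩
        4 * (3 + k) * (2 ^ k * (2 ^ g * 32))             ≤⟨ *-monoˡ-≤ (2 ^ k * (2 ^ g * 32)) (linear≤exp k) ⟩
        3 * 2 ^ (2 + k) * (2 ^ k * (2 ^ g * 32))         ≡⟨ arith₄ (2 ^ k) (2 ^ g) ⟩
        3 * 2 ^ (2 + g) * (32 * (2 ^ k * 2 ^ k))         ≡⟨ cong (λ p → 3 * 2 ^ (2 + g) * (32 * p)) (^-distribˡ-+-* 2 k k) ⟨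
        3 * 2 ^ (2 + g) * (32 * 2 ^ (k + k))             ≡⟨ cong (3 * 2 ^ (2 + g) *_) (^-distribˡ-+-* 2 5 (k + k)) ⟨
        3 * 2 ^ (2 + g) * 2 ^ (5 + (k + k))              ∎))
      where
      open ≤-Reasoning
      arith₁ : ∀ k g → 4 + (k + k) + ((4 + g) + (4 + g)) ≡ (2 + k + (4 + g)) + (2 + k + (4 + g))
      arith₁ = solve-∀
      arith₂ : ∀ k g → 2 + k + (4 + g) ≡ k + (6 + g)
      arith₂ = solve-∀
      arith₃ : ∀ k p q → (6 + (k + k)) * (p * (2 * (2 * (2 * (2 * (2 * (2 * q))))))) ≡ 4 * (3 + k) * (p * (q * 32))
      arith₃ = solve-∀
      arith₄ : ∀ p q → 3 * (2 * (2 * p)) * (p * (q * 32)) ≡ 3 * (2 * (2 * q)) * (32 * (p * p))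
      arith₄ = solve-∀

    by-degree : Tri (card N < 4 + g) (card N ≡ 4 + g) (4 + g < card N) → Result
    by-degree (tri< lt _ _) = inj₂ (DCov-mono (*-monoʳ-≤ M (*-monoˡ-≤ (2 ^ (2 + g)) (≤ᵇ⇒≤ 2 3 tt)))
      (free-DCov (3 + g) (≤-pred lt) (fewer v∈S)))
    by-degree (tri≈ _ d≡ _) with edge? N
    ... | yes e    = inj₂ (edge-DCov (2 + g) v∈S d≡ e (fewer v∈S))
    ... | no indep = independent d≡ indep
    by-degree (tri> _ _ gt) with k , e ← m≤n⇒∃[o]m+o≡n gt =
      large k (trans (sym e) (cong suc (+-comm (4 + g) k)))

  -- The bound has to be strict. An independent neighbourhood of size `4 + g` costs exactly 2^(4+g),
  -- so the loss must come from `S ∖ ⁅ v ⁆` unless that set is complete bipartite. Excess 1 or 2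
  -- spends 17/16, which the gap in `fewer′` repays; from excess 3 on the factor is 7/8.
  odd-step : ∀ g {S M} → 0 < M → card S ≡ suc ((4 + g) + (4 + g)) → (∀ {v} → v ∈ S → DCov (_∈ S ∖ ⁅ v ⁆) M) →
    (∀ {v} → v ∈ S → Bipartition (S ∖ ⁅ v ⁆) (4 + g) ⊎ ∃ λ k → DCov (_∈ S ∖ ⁅ v ⁆) k × k * 17 < 16 * M) →
    Bipartition S (4 + g) ⊎ ∃ λ k → DCov (_∈ S) k × k < M * 2 ^ (4 + g)
  odd-step g {S} {M} 0<M S≡ fewer fewer′
    with v , v∈S , min ← min-degree S (subst (1 ≤_) (sym S≡) (s≤s z≤n)) = by-degree (<-cmp (card N) (4 + g))
    where
    open MinVertex v∈S min

    Result : Set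
    Result = Bipartition S (4 + g) ⊎ ∃ λ k → DCov (_∈ S) k × k < M * 2 ^ (4 + g)

    S′ : Fin n → Bool
    S′ = S ∖ ⁅ v ⁆

    S′≡ : card S′ ≡ (4 + g) + (4 + g)
    S′≡ = suc-injective (trans (sym (card-remove v∈S)) S≡)

    N⊆S′ : N ⊆ S′
    N⊆S′ p = ∈∖ (∩ˡ p) λ e → adj⇒≢ (∩ʳ p) (sym (⁅⁆⇒≡ e))

    smaller : ∀ c → c < 2 ^ (4 + g) → M * c < M * 2 ^ (4 + g)
    smaller c = *-monoʳ-< M {{>-nonZero 0<M}}

    -- An independent set lies within one side of a complete bipartite graph, and by size it is all
    -- of that side; `v` joins the other.
    extend-bipartition : card N ≡ 4 + g → ¬ Edge N → (B : Bipartition S′ (4 + g)) →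
      ∀ {x} → x ∈ N → x ∈ Bipartition.side B → Bipartition S (4 + g)
    extend-bipartition d≡ indep B {x} x∈N x∈A = record
      { side  = adj G v
      ; size  = d≡
      ; cross = crosses
      ; inner = λ xS yS x y xy → indep (_ , ∈∩ xS x , _ , ∈∩ yS y , xy)
      ; outer = outers
      }
      where
      open Bipartition B
      N⊆A : N ⊆ (S′ ∩ side)
      N⊆A {y} p with y ∈? side
      ... | yes q = ∈∩ (N⊆S′ p) q
      ... | no q  = ⊥-elim (indep (x , x∈N , y , p , cross (N⊆S′ x∈N) (N⊆S′ p) x∈A q))
      A⊆N : (S′ ∩ side) ⊆ N
      A⊆N = ⊆-card-≥⇒⊇ N⊆A (≤-reflexive (trans size (sym d≡)))
      crosses : ∀ {x y} → x ∈ S → y ∈ S → x ∈ adj G v → y ∉ adj G v → y ∈ adj G x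
      crosses xS yS p q with ∖-split {v = v} yS
      ... | inj₁ refl = adj-symm p
      ... | inj₂ yS′  = cross (N⊆S′ (∈∩ xS p)) yS′ (∩ʳ (N⊆A (∈∩ xS p))) (λ s → q (∩ʳ (A⊆N (∈∩ yS′ s))))
      outers : ∀ {x y} → x ∈ S → y ∈ S → x ∉ adj G v → y ∉ adj G v → y ∉ adj G x
      outers xS yS p q with ∖-split {v = v} xS | ∖-split {v = v} yS
      ... | inj₁ refl | _         = q
      ... | inj₂ _    | inj₁ refl = p ∘ adj-symm
      ... | inj₂ xS′  | inj₂ yS′  = outer xS′ yS′ (λ s → p (∩ʳ (A⊆N (∈∩ xS′ s)))) (λ s → q (∩ʳ (A⊆N (∈∩ yS′ s))))

    independent : card N ≡ 4 + g → ¬ Edge N → Result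
    independent d≡ indep with fewer′ v∈S
    ... | inj₂ (k , D , lt) = inj₂ (k * 2 ^ (4 + g) , free-DCov (4 + g) (≤-reflexive d≡) D ,
      *-monoˡ-< (2 ^ (4 + g)) {{m^n≢0 2 (4 + g)}} (<-ratio k M lt))
    ... | inj₁ B with x , x∈N ← card>0⇒member {P = N} (subst (1 ≤_) (sym d≡) (s≤s z≤n))
      with x ∈? Bipartition.side B
    ... | yes x∈A = inj₁ (extend-bipartition d≡ indep B x∈N x∈A)
    ... | no x∉A  = inj₁ (extend-bipartition d≡ indep (opposite S′≡ B) x∈N (∈∖ (N⊆S′ x∈N) x∉A))

    -- As `v` has degree below `card S′`, some `w` is not adjacent to it. The degree of `w` would
    -- survive the deletion of `v` and equal `4 + g`, below the minimum degree.
    not-bipartition : 4 + g < card N → card N < (4 + g) + (4 + g) → ¬ Bipartition S′ (4 + g)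
    not-bipartition gt lt B with 1 ≤? card (S′ ∖ adj G v)
    ... | no none = <⇒≱ lt (begin
      (4 + g) + (4 + g)                              ≡⟨ S′≡ ⟨
      card S′                                        ≡⟨ card-split S′ (adj G v) ⟩
      card (S′ ∩ adj G v) + card (S′ ∖ adj G v)      ≡⟨ cong (card (S′ ∩ adj G v) +_) (n<1⇒n≡0 (≰⇒> none)) ⟩
      card (S′ ∩ adj G v) + 0                        ≡⟨ +-identityʳ _ ⟩
      card (S′ ∩ adj G v)                            ≤⟨ card-mono (λ p → ∈∩ (∖ˡ (∩ˡ p)) (∩ʳ p)) ⟩
      card N                                         ∎)
      where open ≤-Reasoning
    ... | yes c with w , p ← card>0⇒member {P = S′ ∖ adj G v} c =
      <⇒≱ gt (begin
        card N                ≤⟨ min (∖ˡ (∖ˡ p)) ⟩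
        card (S ∩ adj G w)    ≤⟨ card-mono (λ q → ∈∩ (∈∖ (∩ˡ q) (λ e → ∖ʳ p (adj-symm (subst (_∈ adj G w) (⁅⁆⇒≡ e) (∩ʳ q))))) (∩ʳ q)) ⟩
        card (S′ ∩ adj G w)   ≡⟨ [ id , id ]′ (bipartition-degree S′≡ B (∖ˡ p)) ⟩
        4 + g                 ∎)
      where open ≤-Reasoning

    slightly-lossy : ∀ b {a} → 4 + g < card N → card N < (4 + g) + (4 + g) → (∀ τ → At.Bd τ N (card N) a b) →
      a * 2 ^ card N ≤ 17 * 2 ^ g * 2 ^ b → Result
    slightly-lossy b gt lt bound le with fewer′ v∈S
    ... | inj₁ B = ⊥-elim (not-bipartition gt lt B)
    ... | inj₂ (k , D , lt′) = inj₂ (k * (17 * 2 ^ g) , eliminate-Bd (17 * 2 ^ g) v∈S D bound le , (begin-strict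
      k * (17 * 2 ^ g)    ≡⟨ *-assoc k 17 (2 ^ g) ⟨
      k * 17 * 2 ^ g      <⟨ *-monoˡ-< (2 ^ g) {{m^n≢0 2 g}} lt′ ⟩
      16 * M * 2 ^ g      ≡⟨ arith M (2 ^ g) ⟩
      M * 2 ^ (4 + g)     ∎))
      where
      open ≤-Reasoning
      arith : ∀ m p → 16 * m * p ≡ m * (2 * (2 * (2 * (2 * p))))
      arith = solve-∀

    large : ∀ k → card N ≡ suc k + (4 + g) → Result
    large 0 d≡ = slightly-lossy 5 (≤-reflexive (sym d≡)) (subst (_< (4 + g) + (4 + g)) (sym d≡) lt)
      (λ τ → At.minDeg₁-5 τ (nbhd-minDeg 1 (≤-reflexive (trans (cong (1 +_) S≡) (trans (arith₁ g) (cong₂ _+_ (sym d≡) (sym d≡))))))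
        (subst (5 ≤_) (sym d≡) (s≤s (m≤m+n 4 g))))
      (≤-reflexive (trans (cong (λ d → 17 * 2 ^ d) d≡) (arith₂ (2 ^ g))))
      where
      lt : suc (5 + g) ≤ (4 + g) + (4 + g)
      lt = ≤-trans (≤-reflexive (cong (4 +_) (+-comm 2 g))) (+-monoʳ-≤ (4 + g) (s≤s (s≤s z≤n)))
      arith₁ : ∀ g → 1 + suc ((4 + g) + (4 + g)) ≡ (5 + g) + (5 + g)
      arith₁ = solve-∀
      arith₂ : ∀ p → 17 * (2 * (2 * (2 * (2 * (2 * p))))) ≡ 17 * p * 32
      arith₂ = solve-∀
    large 1 d≡ = slightly-lossy 6 (≤-trans (n≤1+n _) (≤-reflexive (sym d≡))) (subst (_< (4 + g) + (4 + g)) (sym d≡) lt)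
      (λ τ → At.minDeg₃-6 τ (nbhd-minDeg 3 (≤-reflexive (trans (cong (3 +_) S≡) (trans (arith₁ g) (cong₂ _+_ (sym d≡) (sym d≡))))))
        (subst (6 ≤_) (sym d≡) (s≤s (s≤s (m≤m+n 4 g)))))
      (≤-reflexive (trans (cong (λ d → 17 * 2 ^ d) d≡) (arith₂ (2 ^ g))))
      where
      lt : suc (6 + g) ≤ (4 + g) + (4 + g)
      lt = ≤-trans (≤-reflexive (cong (4 +_) (+-comm 3 g))) (+-monoʳ-≤ (4 + g) (s≤s (s≤s (s≤s z≤n))))
      arith₁ : ∀ g → 3 + suc ((4 + g) + (4 + g)) ≡ (6 + g) + (6 + g)
      arith₁ = solve-∀
      arith₂ : ∀ p → 17 * (2 * (2 * (2 * (2 * (2 * (2 * p)))))) ≡ 17 * p * 64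
      arith₂ = solve-∀
    large (suc (suc j)) d≡ = inj₂ (M * (7 * 2 ^ (1 + g)) , eliminate-Bd (7 * 2 ^ (1 + g)) v∈S (fewer v∈S)
      (λ τ → At.minDeg-bound τ (5 + 2 * j) (subst (1 ≤_) (sym d≡) (s≤s z≤n))
        (nbhd-minDeg (5 + 2 * j) (≤-reflexive (trans (cong (5 + 2 * j +_) S≡) (trans (arith₁ j g) (cong₂ _+_ (sym d≡) (sym d≡)))))))
      (begin
        (7 + 2 * j) * 2 ^ card N                     ≡⟨ cong (λ d → (7 + 2 * j) * 2 ^ d) (trans d≡ (arith₂ j g)) ⟩
        (7 + 2 * j) * 2 ^ (j + (7 + g))              ≤⟨ *-monoˡ-≤ (2 ^ (j + (7 + g))) (linear≤exp′ j) ⟩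
        7 * 2 ^ j * 2 ^ (j + (7 + g))                ≡⟨ cong (7 * 2 ^ j *_) (^-distribˡ-+-* 2 j (7 + g)) ⟩
        7 * 2 ^ j * (2 ^ j * 2 ^ (7 + g))            ≡⟨ arith₃ (2 ^ j) (2 ^ g) ⟩
        7 * 2 ^ (1 + g) * (64 * (2 ^ j * 2 ^ j))     ≡⟨ cong (λ p → 7 * 2 ^ (1 + g) * (64 * p))
          (trans (cong (λ i → 2 ^ (j + i)) (+-identityʳ j)) (^-distribˡ-+-* 2 j j)) ⟨
        7 * 2 ^ (1 + g) * (64 * 2 ^ (2 * j))         ≡⟨ cong (7 * 2 ^ (1 + g) *_) (^-distribˡ-+-* 2 6 (2 * j)) ⟨
        7 * 2 ^ (1 + g) * 2 ^ (6 + 2 * j)            ∎) ,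
      smaller (7 * 2 ^ (1 + g)) (subst (7 * 2 ^ (1 + g) <_) (arith₄ (2 ^ (1 + g)))
        (*-monoˡ-< (2 ^ (1 + g)) {{m^n≢0 2 (1 + g)}} (≤ᵇ⇒≤ 8 8 tt))))
      where
      open ≤-Reasoning
      arith₁ : ∀ j g → 5 + 2 * j + suc ((4 + g) + (4 + g)) ≡ (3 + j + (4 + g)) + (3 + j + (4 + g))
      arith₁ = solve-∀
      arith₂ : ∀ j g → 3 + j + (4 + g) ≡ j + (7 + g)
      arith₂ = solve-∀
      arith₃ : ∀ p q → 7 * p * (p * (2 * (2 * (2 * (2 * (2 * (2 * (2 * q)))))))) ≡ 7 * (2 * q) * (64 * (p * p))
      arith₃ = solve-∀
      arith₄ : ∀ p → 8 * p ≡ 2 * (2 * (2 * p))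
      arith₄ = solve-∀

    by-degree : Tri (card N < 4 + g) (card N ≡ 4 + g) (4 + g < card N) → Result
    by-degree (tri< lt _ _) = inj₂ (M * 2 ^ (3 + g) , free-DCov (3 + g) (≤-pred lt) (fewer v∈S) ,
      smaller (2 ^ (3 + g)) (^-monoʳ-< 2 (s≤s (s≤s z≤n)) {3 + g} {4 + g} ≤-refl))
    by-degree (tri≈ _ d≡ _) with edge? N
    ... | yes e    = inj₂ (M * (3 * 2 ^ (2 + g)) , edge-DCov (2 + g) v∈S d≡ e (fewer v∈S) ,
      smaller (3 * 2 ^ (2 + g)) (subst (3 * 2 ^ (2 + g) <_) (arith (2 ^ (2 + g)))
        (*-monoˡ-< (2 ^ (2 + g)) {{m^n≢0 2 (2 + g)}} (≤ᵇ⇒≤ 4 4 tt))))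
      where
      arith : ∀ p → 4 * p ≡ 2 * (2 * p)
      arith = solve-∀
    ... | no indep = independent d≡ indep
    by-degree (tri> _ _ gt) with k , e ← m≤n⇒∃[o]m+o≡n gt =
      large k (trans (sym e) (cong suc (+-comm (4 + g) k)))

  -- Only even sizes carry the gap 16/17, because only odd steps spend it. `2 ^ (h * h) * 2 ^ h` is
  -- 2^⌊n²/4⌋ at n = 2h + 1.
  EvenResult OddResult : ℕ → (Fin n → Bool) → Set
  EvenResult h S = Bipartition S h ⊎ ∃ λ k → DCov (_∈ S) k × k * 17 < 16 * 2 ^ (h * h)
  OddResult  h S = Bipartition S h ⊎ ∃ λ k → DCov (_∈ S) k × k < 2 ^ (h * h) * 2 ^ h

  even-DCov : ∀ h {S} → card S ≡ h + h → EvenResult h S → DCov (_∈ S) (2 ^ (h * h))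
  even-DCov h S≡ (inj₁ B)            = Bipartition-DCov S≡ B
  even-DCov h S≡ (inj₂ (k , D , lt)) = DCov-mono (<⇒≤ (<-ratio k (2 ^ (h * h)) lt)) D

  odd-DCov : ∀ h {S} → card S ≡ suc (h + h) → OddResult h S → DCov (_∈ S) (2 ^ (h * h) * 2 ^ h)
  odd-DCov h S≡ (inj₁ B) = DCov-mono
    (≤-reflexive (trans (cong (2 ^_) (trans (*-suc h h) (+-comm h (h * h)))) (^-distribˡ-+-* 2 (h * h) h)))
    (Bipartition-DCov (trans S≡ (sym (+-suc h h))) B)
  odd-DCov h S≡ (inj₂ (k , D , lt)) = DCov-mono (<⇒≤ lt) D

  even-result : ∀ g S → card S ≡ (4 + g) + (4 + g) → EvenResult (4 + g) S
  odd-result  : ∀ g S → card S ≡ suc ((4 + g) + (4 + g)) → OddResult (4 + g) S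

  -- 7! · 12 · 17 = 1028160 against 16 · 2^16 = 1048576.
  even-result zero S S≡ = Sum.map₂ (λ D → 7 ! * (3 * 2 ^ 2) , D , <ᵇ⇒< (5040 * 12 * 17) (16 * 2 ^ 16) tt)
    (even-step zero {M = 7 !} S≡ λ {v} v∈S → let c = suc-injective (trans (sym (card-remove v∈S)) S≡) in
      subst (λ k → DCov (_∈ S ∖ ⁅ v ⁆) (k !)) c (small (S ∖ ⁅ v ⁆) (≤-reflexive c)))
  even-result (suc g) S S≡ = Sum.map₂ (λ D → _ , D , bound)
    (even-step (suc g) S≡ λ {v} v∈S → let c = trans (suc-injective (trans (sym (card-remove v∈S)) S≡)) (+-suc (4 + g) (4 + g)) in
      odd-DCov (4 + g) c (odd-result g (S ∖ ⁅ v ⁆) c))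
    where
    open ≤-Reasoning
    h : ℕ
    h = 4 + g
    arith₁ : ∀ p q r → p * (2 * (2 * (2 * (2 * q)))) * (3 * (2 * (2 * (2 * r)))) * 17 ≡ 408 * p * (2 * (2 * (2 * (2 * q)))) * r
    arith₁ = solve-∀
    arith₂ : ∀ p q r → 512 * p * (2 * (2 * (2 * (2 * q)))) * r ≡ 16 * (2 * (2 * (2 * (2 * (2 * r)))) * (p * (2 * (2 * (2 * (2 * q))))))
    arith₂ = solve-∀
    -- This is 17 · 3/4 < 16, scaled by 32: 408 = 17 · 24 and 512 = 16 · 32.
    bound : 2 ^ (h * h) * 2 ^ h * (3 * 2 ^ (3 + g)) * 17 < 16 * 2 ^ (suc h * suc h)
    bound = begin-strict
      2 ^ (h * h) * 2 ^ h * (3 * 2 ^ (3 + g)) * 17   ≡⟨ arith₁ (2 ^ (h * h)) (2 ^ g) (2 ^ g) ⟩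
      408 * 2 ^ (h * h) * 2 ^ h * 2 ^ g
        <⟨ *-monoˡ-< (2 ^ g) {{m^n≢0 2 g}} (*-monoˡ-< (2 ^ h) {{m^n≢0 2 h}}
          (*-monoˡ-< (2 ^ (h * h)) {{m^n≢0 2 (h * h)}} (<ᵇ⇒< 408 512 tt))) ⟩
      512 * 2 ^ (h * h) * 2 ^ h * 2 ^ g              ≡⟨ arith₂ (2 ^ (h * h)) (2 ^ g) (2 ^ g) ⟩
      16 * (2 ^ suc h * (2 ^ (h * h) * 2 ^ h))       ≡⟨ cong (λ p → 16 * (2 ^ suc h * p)) (^-distribˡ-+-* 2 (h * h) h) ⟨
      16 * (2 ^ suc h * 2 ^ (h * h + h))             ≡⟨ cong (16 *_) (^-distribˡ-+-* 2 (suc h) (h * h + h)) ⟨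
      16 * 2 ^ (suc h + (h * h + h))                 ≡⟨ cong (λ k → 16 * 2 ^ (suc h + k)) (trans (+-comm (h * h) h) (sym (*-suc h h))) ⟩
      16 * 2 ^ (suc h * suc h)                       ∎

  odd-result g S S≡ = odd-step g (m^n>0 2 ((4 + g) * (4 + g))) S≡
    (λ {v} v∈S → even-DCov (4 + g) (c v∈S) (even-result g (S ∖ ⁅ v ⁆) (c v∈S)))
    (λ {v} v∈S → even-result g (S ∖ ⁅ v ⁆) (c v∈S))
    where
    c : ∀ {v} → v ∈ S → card (S ∖ ⁅ v ⁆) ≡ (4 + g) + (4 + g)
    c v∈S = suc-injective (trans (sym (card-remove v∈S)) S≡)

-- Counting codes

any-intro : ∀ {A : Set} (p : A → Bool) {x xs} → x ∈ˡ xs → p x ≡ true → any p xs ≡ true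
any-intro p (here refl) e rewrite e = refl
any-intro p {xs = x ∷ xs} (there i) e with p x
... | true  = refl
... | false = any-intro p i e

all-elim : ∀ {A : Set} (p : A → Bool) {x xs} → all p xs ≡ true → x ∈ˡ xs → p x ≡ true
all-elim p {xs = x ∷ xs} e (here refl) = proj₁ (∧-true (p x) e)
all-elim p {xs = x ∷ xs} e (there i)   = all-elim p (proj₂ (∧-true (p x) e)) i

AllPairs-lookup : ∀ {A : Set} {R : A → A → Set} {xs} → AllPairs R xs → ∀ i j → i ≢ j →
  R (List.lookup xs i) (List.lookup xs j) ⊎ R (List.lookup xs j) (List.lookup xs i)
AllPairs-lookup (_  ∷ _)  zero    zero    i≢j = ⊥-elim (i≢j refl)
AllPairs-lookup (px ∷ _)  zero    (suc j) _   = inj₁ (All.lookup px (∈-lookup j))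
AllPairs-lookup (px ∷ _)  (suc i) zero    _   = inj₂ (All.lookup px (∈-lookup i))
AllPairs-lookup (_  ∷ ps) (suc i) (suc j) i≢j = AllPairs-lookup ps i j (i≢j ∘ cong suc)

-- Codes are functions and are told apart pointwise, so `xs` is distinct only up to `_~_`.
pigeonhole : ∀ {A B : Set} {R : A → B → Set} {_~_ : A → A → Set} {xs : List A} {ys : List B} →
  (∀ {x} → x ∈ˡ xs → Any (R x) ys) →
  (∀ {x x′ y} → x ∈ˡ xs → x′ ∈ˡ xs → R x y → R x′ y → x ~ x′) →
  AllPairs (λ x x′ → ¬ x ~ x′) xs → length xs ≤ length ys
pigeonhole {R = R} {_~_} {xs} {ys} cov same distinct = Fin.injective⇒≤ {f = hole} hole-injective
  where
  hole : Fin (length xs) → Fin (length ys)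
  hole i = Any.index (cov (∈-lookup {xs = xs} i))
  related : ∀ i → R (List.lookup xs i) (List.lookup ys (hole i))
  related i = Any.lookup-index (cov (∈-lookup {xs = xs} i))
  collide : ∀ i j → hole i ≡ hole j → List.lookup xs i ~ List.lookup xs j
  collide i j e = same (∈-lookup i) (∈-lookup j) (related i) (subst (R _ ∘ List.lookup ys) (sym e) (related j))
  hole-injective : ∀ {i j} → hole i ≡ hole j → i ≡ j
  hole-injective {i} {j} e with i Fin.≟ j
  ... | yes i≡j = i≡j
  ... | no i≢j  = [ (λ n → ⊥-elim (n (collide i j e))) , (λ n → ⊥-elim (n (collide j i (sym e)))) ]′
    (AllPairs-lookup distinct i j i≢j)

allFns-distinct : ∀ {B : Set} {_~_ : B → B → Set} k {bs} → AllPairs (λ b c → ¬ b ~ c) bs →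
  AllPairs (λ f g → ¬ (∀ i → f i ~ g i)) (allFns k bs)
allFns-distinct zero    d = [] ∷ []
allFns-distinct (suc k) {bs} d = AllPairs.concat⁺
  (All.map⁺ (All.tabulate λ _ → AllPairs.map⁺ (AllPairs.map (λ n e → n (e ∘ suc)) (allFns-distinct k d))))
  (AllPairs.map⁺ (AllPairs.map (λ n → All.map⁺ (All.tabulate λ _ → All.map⁺ (All.tabulate λ _ e → n (e zero)))) d))

allCodes-distinct : ∀ n → AllPairs (λ σ τ → ¬ (∀ i j → σ i j ≡ τ i j)) (allCodes n)
allCodes-distinct n = allFns-distinct {_~_ = λ f g → ∀ j → f j ≡ g j} n (allFns-distinct {_~_ = _≡_} n (((λ ()) ∷ []) ∷ [] ∷ []))

number : ∀ {A : Set} → (A → Bool) → List A → ℕ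
number P xs = length (filterᵇ P xs)

number-cong : ∀ {A : Set} {P Q : A → Bool} → (∀ x → P x ≡ Q x) → ∀ xs → number P xs ≡ number Q xs
number-cong e [] = refl
number-cong {P = P} {Q} e (x ∷ xs) with P x | Q x | e x
... | true  | _ | refl = cong suc (number-cong e xs)
... | false | _ | refl = number-cong e xs

number-++ : ∀ {A : Set} (P : A → Bool) xs ys → number P (xs ++ ys) ≡ number P xs + number P ys
number-++ P []       ys = refl
number-++ P (x ∷ xs) ys with P x
... | true  = cong suc (number-++ P xs ys)
... | false = number-++ P xs ys

number-map : ∀ {A B : Set} (P : B → Bool) (f : A → B) xs → number P (List.map f xs) ≡ number (P ∘ f) xs
number-map P f []       = refl
number-map P f (x ∷ xs) with P (f x)
... | true  = cong suc (number-map P f xs)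
... | false = number-map P f xs

number-none : ∀ {A : Set} (xs : List A) → number (λ _ → false) xs ≡ 0
number-none []       = refl
number-none (x ∷ xs) = number-none xs

all-tabulate : ∀ {A : Set} (p : A → Bool) {k} (f : Fin k → A) → all p (tabulate f) ≡ all (p ∘ f) (allFin k)
all-tabulate p {zero}  f = refl
all-tabulate p {suc k} f = cong (p (f zero) ∧_)
  (trans (all-tabulate p (f ∘ suc)) (sym (all-tabulate (p ∘ f) suc)))

product : ∀ {k} → (Fin k → ℕ) → ℕ
product {zero}  f = 1
product {suc k} f = f zero * product (f ∘ suc)

product-2^ : ∀ {k} (e : Fin k → ℕ) → product (λ i → 2 ^ e i) ≡ 2 ^ sum e
product-2^ {zero}  e = refl
product-2^ {suc k} e = trans (cong (2 ^ e zero *_) (product-2^ (e ∘ suc))) (sym (^-distribˡ-+-* 2 (e zero) _))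

product-cong : ∀ {k} {f g : Fin k → ℕ} → (∀ i → f i ≡ g i) → product f ≡ product g
product-cong {zero}  e = refl
product-cong {suc k} e = cong₂ _*_ (e zero) (product-cong (e ∘ suc))

number-allFns : ∀ {B : Set} k (P : Fin k → B → Bool) (bs : List B) →
  number (λ f → all (λ i → P i (f i)) (allFin k)) (allFns k bs) ≡ product (λ i → number (P i) bs)
number-allFns zero    P bs = refl
number-allFns {B} (suc k) P bs = trans
  (number-cong (λ f → cong (P zero (f zero) ∧_) (all-tabulate (λ i → P i (f i)) suc)) (allFns (suc k) bs))
  (trans (heads (λ _ _ → refl) bs) (cong (number (P zero) bs *_) (number-allFns k (P ∘ suc) bs)))
  where
  R : (Fin k → B) → Bool
  R f = all (λ i → P (suc i) (f i)) (allFin k)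
  -- `c` stands for the pattern-matching lambda in `allFns`: writing it out again would define a
  -- different function.
  heads : ∀ {c : B → (Fin k → B) → Fin (suc k) → B} →
    (∀ b f → (P zero (c b f zero) ∧ R (c b f ∘ suc)) ≡ (P zero b ∧ R f)) → ∀ cs →
    number (λ f → P zero (f zero) ∧ R (f ∘ suc)) (concatMap (λ b → List.map (λ f → c b f) (allFns k bs)) cs)
    ≡ number (P zero) cs * number R (allFns k bs)
  heads e [] = refl
  heads {c} e (b ∷ cs) = trans (number-++ _ (List.map (c b) (allFns k bs)) _)
    (trans (cong₂ _+_ (trans (number-map _ (c b) (allFns k bs)) (number-cong (e b) (allFns k bs))) (heads {c} e cs)) split)
    where
    split : number (λ f → P zero b ∧ R f) (allFns k bs) + number (P zero) cs * number R (allFns k bs)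
      ≡ number (P zero) (b ∷ cs) * number R (allFns k bs)
    split with P zero b
    ... | true  = refl
    ... | false = cong (_+ number (P zero) cs * number R (allFns k bs)) (number-none (allFns k bs))

count≡sum : ∀ {k} (P : Fin k → Bool) → count P ≡ sum (bit ∘ P)
count≡sum {zero}  P = refl
count≡sum {suc k} P = cong (bit (P zero) +_) (count≡sum (P ∘ suc))

sum-if : ∀ {k} (P : Fin k → Bool) a b →
  sum (λ i → if P i then a else b) ≡ count P * a + count (not ∘ P) * b
sum-if {zero}  P a b = refl
sum-if {suc k} P a b with P zero
... | true  = trans (cong (a +_) (sum-if (P ∘ suc) a b)) (sym (+-assoc a _ _))
... | false = trans (cong (b +_) (sum-if (P ∘ suc) a b)) (arith b (count (P ∘ suc) * a) (count (not ∘ P ∘ suc) * b))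
  where
  arith : ∀ x y z → x + (y + z) ≡ y + (x + z)
  arith = solve-∀

count-<ᵇ : ∀ n k → k ≤ n → count {n} (λ i → toℕ i <ᵇ k) ≡ k
count-<ᵇ n       zero    _        = trans (sym (card≡count _)) (card-empty {n} {P = λ i → toℕ i <ᵇ 0} λ { (mem ()) })
count-<ᵇ (suc n) (suc k) (s≤s le) = cong suc (count-<ᵇ n k le)

count-permute : ∀ {n} (P : Fin n → Bool) (π : Permutation′ n) → count (P ∘ (π ⟨$⟩ʳ_)) ≡ count P
count-permute P π = trans (count≡sum (P ∘ (π ⟨$⟩ʳ_))) (trans (sym (sum-permute (bit ∘ P) π)) (sym (count≡sum P)))

count≤n : ∀ {n} (P : Fin n → Bool) → count P ≤ n
count≤n {zero}  P = z≤n
count≤n {suc n} P with P zero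
... | true  = s≤s (count≤n (P ∘ suc))
... | false = ≤-trans (count≤n (P ∘ suc)) (n≤1+n n)

punchIn-<ᵇ : ∀ {n} (k : Fin (suc n)) r → (toℕ (punchIn k r) <ᵇ toℕ k) ≡ (toℕ r <ᵇ toℕ k)
punchIn-<ᵇ zero    zero    = refl
punchIn-<ᵇ zero    (suc r) = refl
punchIn-<ᵇ (suc k) zero    = refl
punchIn-<ᵇ (suc k) (suc r) = punchIn-<ᵇ k r

n≮ᵇn : ∀ n → (n <ᵇ n) ≡ false
n≮ᵇn zero    = refl
n≮ᵇn (suc n) = n≮ᵇn n

sorting : ∀ {n} (P : Fin n → Bool) → Σ (Permutation′ n) λ π → ∀ i → P (π ⟨$⟩ʳ i) ≡ (toℕ i <ᵇ count P)
sorting {zero}  P = Perm.id , λ ()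
sorting {suc n} P with P zero in p | sorting (P ∘ suc)
... | true  | π , e = Perm.lift₀ π , λ { zero → p ; (suc i) → e i }
-- `zero` is not in `P`, so it goes to position `c`, directly behind all members.
... | false | π , e = Perm.insert k zero π , sorted
  where
  c : ℕ
  c = count (P ∘ suc)
  c<1+n : c < suc n
  c<1+n = s≤s (count≤n (P ∘ suc))
  k : Fin (suc n)
  k = fromℕ< c<1+n
  toℕ-k : toℕ k ≡ c
  toℕ-k = Fin.toℕ-fromℕ< c<1+n
  sorted : ∀ i → P (Perm.insert k zero π ⟨$⟩ʳ i) ≡ (toℕ i <ᵇ c)
  sorted i with k Fin.≟ i
  ... | yes refl rewrite toℕ-k = trans p (sym (n≮ᵇn c))
  ... | no k≢i = trans (e (punchOut k≢i)) (subst₂ (λ b j → (toℕ (punchOut k≢i) <ᵇ b) ≡ (toℕ j <ᵇ b))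
    toℕ-k (Fin.punchIn-punchOut k≢i) (sym (punchIn-<ᵇ k (punchOut k≢i))))

full : ∀ {n} → Fin n → Bool
full _ = true

-- From covering lists and bipartitions to `D`

module Count {n : ℕ} (G : Graph n) where
  open Orientations G
  open Induction G

  valid : Code n → Bool
  valid σ = normalised G σ ∧ not (hasCyclicTriangle G σ)

  -- A normalised code can be read off from its arcs, so agreement of arcs identifies normalised
  -- codes.
  normalised-arc : ∀ σ → normalised G σ ≡ true → ∀ i j → σ i j ≡ (arc G σ i j ∧ (i ≺ j))
  normalised-arc σ e i j with adj G i j | i ≺ j | σ i j | all-elim _ (all-elim _ e (∈-allFin i)) (∈-allFin j)
  ... | false | _     | false | _ = refl
  ... | true  | false | false | _ = sym (∧-zeroʳ _)
  ... | true  | true  | false | _ = refl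
  ... | true  | true  | true  | _ = refl

  acyclic-free : ∀ σ → not (hasCyclicTriangle G σ) ≡ true → Free (_∈ full) σ
  acyclic-free σ e {x} {y} {z} _ _ _ (mem xy) (mem yz) (mem zx) = not-both
    (any-intro _ (∈-allFin x) (any-intro _ (∈-allFin y) (any-intro _ (∈-allFin z)
      (trans (cong₂ (λ a b → a ∧ b ∧ arc G σ z x) xy yz) zx)))) e

  DCov⇒D≤ : ∀ {k} → DCov (_∈ full) k → D G ≤ k
  DCov⇒D≤ (L , le , cov) = ≤-trans (pigeonhole {R = Agree (_∈ full)} {_~_ = λ σ τ → ∀ i j → σ i j ≡ τ i j}
    (λ {σ} σ∈ → cov σ (acyclic-free σ (proj₂ (∧-true (normalised G σ) (is-valid σ∈)))))
    (λ {σ} {τ} σ∈ τ∈ (agreeing e) (agreeing e′) i j → trans (normalised-arc σ (proj₁ (∧-true _ (is-valid σ∈))) i j)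
      (trans (cong (_∧ (i ≺ j)) (trans (e {i} {j} (mem refl) (mem refl)) (sym (e′ {i} {j} (mem refl) (mem refl)))))
        (sym (normalised-arc τ (proj₁ (∧-true _ (is-valid τ∈))) i j))))
    (AllPairs.filter⁺ (T? ∘ valid) (allCodes-distinct n))) le
    where
    is-valid : ∀ {σ} → σ ∈ˡ filterᵇ valid (allCodes n) → valid σ ≡ true
    is-valid σ∈ = Equivalence.to T-≡ (proj₂ (∈-filter⁻ (T? ∘ valid) {xs = allCodes n} σ∈))

  edges : ℕ
  edges = sum (λ i → count (λ j → adj G i j ∧ (i ≺ j)))

  count-split : ∀ {k} (P Q : Fin k → Bool) → count P ≡ count (λ j → P j ∧ Q j) + count (λ j → P j ∧ not (Q j))
  count-split P Q = begin
    count P                              ≡⟨ card≡count P ⟨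
    card P                               ≡⟨ card-split P Q ⟩
    card (P ∩ Q) + card (P ∖ Q)          ≡⟨ cong₂ _+_
      (card-cong {Q = λ j → P j ∧ Q j} (λ p → mem (trans (cong (_∧ _) (holds (∩ˡ p))) (holds (∩ʳ p))))
        (λ { (mem e) → let p , q = ∧-true _ e in ∈∩ (mem p) (mem q) }))
      (card-cong {Q = λ j → P j ∧ not (Q j)} (λ p → mem (trans (cong (_∧ _) (holds (∖ˡ p))) (cong not (∉⇒false {P = Q} (∖ʳ p)))))
        (λ { (mem e) → let p , q = ∧-true _ e in ∈∖ (mem p) (λ { (mem r) → not-both r q }) })) ⟩
    card (λ j → P j ∧ Q j) + card (λ j → P j ∧ not (Q j)) ≡⟨ cong₂ _+_ (card≡count _) (card≡count _) ⟩
    count (λ j → P j ∧ Q j) + count (λ j → P j ∧ not (Q j)) ∎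
    where open ≡-Reasoning

  handshake : edges + edges ≡ sum (λ i → count (adj G i))
  handshake = begin
    edges + edges
      ≡⟨ cong (edges +_) flipped ⟩
    edges + sum (λ i → count (λ j → adj G i j ∧ not (i ≺ j)))
      ≡⟨ ∑-distrib-+ (λ i → count (λ j → adj G i j ∧ (i ≺ j))) (λ i → count (λ j → adj G i j ∧ not (i ≺ j))) ⟨
    sum (λ i → count (λ j → adj G i j ∧ (i ≺ j)) + count (λ j → adj G i j ∧ not (i ≺ j)))
      ≡⟨ sum-cong-≗ (λ i → count-split (adj G i) (i ≺_)) ⟨
    sum (λ i → count (adj G i)) ∎
    where
    open ≡-Reasoning
    flip : ∀ i j → (adj G i j ∧ (i ≺ j)) ≡ (adj G j i ∧ not (j ≺ i))
    flip i j with j ∈? adj G i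
    ... | yes (mem e) = cong₂ _∧_ (adj-sym G i j) (≺-flip (adj⇒≢ (adj-symm (mem e))))
    ... | no q = trans (cong (_∧ (i ≺ j)) (∉⇒false {P = adj G i} q))
      (sym (cong (_∧ not (j ≺ i)) (∉⇒false {P = adj G j} (q ∘ adj-symm))))
    flipped : edges ≡ sum (λ i → count (λ j → adj G i j ∧ not (i ≺ j)))
    flipped = begin
      edges
        ≡⟨ sum-cong-≗ (λ i → trans (count-cong (flip i)) (count≡sum (λ j → adj G j i ∧ not (j ≺ i)))) ⟩
      sum (λ i → sum (λ j → bit (adj G j i ∧ not (j ≺ i))))
        ≡⟨ ∑-comm (λ i j → bit (adj G j i ∧ not (j ≺ i))) ⟩
      sum (λ j → sum (λ i → bit (adj G j i ∧ not (j ≺ i))))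
        ≡⟨ sum-cong-≗ (λ j → count≡sum (λ i → adj G j i ∧ not (j ≺ i))) ⟨
      sum (λ i → count (λ j → adj G i j ∧ not (i ≺ j))) ∎

  -- A normalised code has a free bit at each edge and a forced `false` elsewhere, so the count is a
  -- product over all pairs.
  number-normalised : number (normalised G) (allCodes n) ≡ 2 ^ edges
  number-normalised = trans (number-allFns n row (allFns n (true ∷ false ∷ [])))
    (trans (product-cong (λ i → trans (number-allFns n (cell i) (true ∷ false ∷ []))
      (trans (product-cong (two i)) (trans (product-2^ (λ j → bit (adj G i j ∧ (i ≺ j))))
        (cong (2 ^_) (sym (count≡sum (λ j → adj G i j ∧ (i ≺ j)))))))))
      (product-2^ (λ i → count (λ j → adj G i j ∧ (i ≺ j)))))
    where
    cell : Fin n → Fin n → Bool → Bool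
    cell i j b = not b ∨ (adj G i j ∧ (i ≺ j))
    row : Fin n → (Fin n → Bool) → Bool
    row i r = all (λ j → cell i j (r j)) (allFin n)
    two : ∀ i j → number (cell i j) (true ∷ false ∷ []) ≡ 2 ^ bit (adj G i j ∧ (i ≺ j))
    two i j with adj G i j ∧ (i ≺ j)
    ... | true  = refl
    ... | false = refl

  module _ {a b : ℕ} (n≡ : n ≡ a + b) (B : Bipartition full a) where
    open Bipartition B

    full≡ : card (full {n}) ≡ a + b
    full≡ = trans card-full n≡

    size-side : count side ≡ a
    size-side = trans (sym (card≡count side)) (trans (card-cong (λ p → ∈∩ (mem refl) p) ∩ʳ) size)

    size-other : count (not ∘ side) ≡ b
    size-other = trans (sym (card≡count _)) (trans (card-cong {Q = full ∖ side}
      (λ { (mem p) → ∈∖ (mem refl) (λ { (mem q) → not-both q p }) })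
      (λ p → mem (cong not (∉⇒false {P = side} (∖ʳ p))))) (other-size full≡ B))

    degrees : ∀ i → count (adj G i) ≡ (if side i then b else a)
    degrees i with i ∈? side
    ... | yes p rewrite holds p = trans (count-cong lem) size-other
      where
      lem : ∀ j → adj G i j ≡ not (side j)
      lem j with j ∈? side
      ... | yes q = trans (∉⇒false {P = adj G i} (inner (mem refl) (mem refl) p q)) (cong not (sym (holds q)))
      ... | no q  = trans (holds (cross (mem refl) (mem refl) p q)) (cong not (sym (∉⇒false {P = side} q)))
    ... | no p rewrite ∉⇒false {P = side} p = trans (count-cong lem) size-side
      where
      lem : ∀ j → adj G i j ≡ side j
      lem j with j ∈? side
      ... | yes q = trans (holds (adj-symm (cross (mem refl) (mem refl) q p))) (sym (holds q))
      ... | no q  = trans (∉⇒false {P = adj G i} (outer (mem refl) (mem refl) p q)) (sym (∉⇒false {P = side} q))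

    edges≡ : edges ≡ a * b
    edges≡ = *-cancelˡ-≡ edges (a * b) 2 (begin
      2 * edges                                 ≡⟨ cong (edges +_) (+-identityʳ edges) ⟩
      edges + edges                             ≡⟨ handshake ⟩
      sum (λ i → count (adj G i))               ≡⟨ sum-cong-≗ degrees ⟩
      sum (λ i → if side i then b else a)       ≡⟨ sum-if side b a ⟩
      count side * b + count (not ∘ side) * a   ≡⟨ cong₂ (λ x y → x * b + y * a) size-side size-other ⟩
      a * b + b * a                             ≡⟨ cong (a * b +_) (trans (*-comm b a) (sym (+-identityʳ (a * b)))) ⟩
      2 * (a * b)                               ∎)
      where open ≡-Reasoning

    no-triangle : ∀ {x y z} → y ∈ adj G x → z ∈ adj G y → x ∉ adj G z
    no-triangle {x} {y} {z} xy yz zx with x ∈? side | y ∈? side | z ∈? side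
    ... | yes p | yes q | _     = inner (mem refl) (mem refl) p q xy
    ... | no p  | no q  | _     = outer (mem refl) (mem refl) p q xy
    ... | _     | yes q | yes r = inner (mem refl) (mem refl) q r yz
    ... | _     | no q  | no r  = outer (mem refl) (mem refl) q r yz
    ... | yes p | _     | yes r = inner (mem refl) (mem refl) r p zx
    ... | no p  | _     | no r  = outer (mem refl) (mem refl) r p zx

    acyclic : ∀ σ → hasCyclicTriangle G σ ≡ false
    acyclic σ with hasCyclicTriangle G σ in e
    ... | false = refl
    ... | true with x , _ , e₁ ← any-true _ (allFin n) e
      with y , _ , e₂ ← any-true _ (allFin n) e₁ with z , _ , e₃ ← any-true _ (allFin n) e₂
      with xy , e₄ ← ∧-true (arc G σ x y) e₃ with yz , zx ← ∧-true (arc G σ y z) e₄ =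
      ⊥-elim (no-triangle (arc⊆adj {σ} (mem xy)) (arc⊆adj {σ} (mem yz)) (arc⊆adj {σ} (mem zx)))

    -- There are no triangles, so every orientation counts. This is the only source of lower bounds
    -- on `D`.
    bipartition-D : D G ≡ 2 ^ (a * b)
    bipartition-D = trans (number-cong valid≡normalised (allCodes n)) (trans number-normalised (cong (2 ^_) edges≡))
      where
      valid≡normalised : ∀ σ → valid σ ≡ normalised G σ
      valid≡normalised σ rewrite acyclic σ = ∧-identityʳ (normalised G σ)

    adj-xor : ∀ x y → adj G x y ≡ (if side x then not (side y) else side y)
    adj-xor x y with x ∈? side | y ∈? side
    ... | yes p | yes q rewrite holds p | holds q = ∉⇒false {P = adj G x} (inner (mem refl) (mem refl) p q)
    ... | yes p | no q rewrite holds p | ∉⇒false {P = side} q = holds (cross (mem refl) (mem refl) p q)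
    ... | no p | yes q rewrite ∉⇒false {P = side} p | holds q = holds (adj-symm (cross (mem refl) (mem refl) q p))
    ... | no p | no q rewrite ∉⇒false {P = side} p | ∉⇒false {P = side} q = ∉⇒false {P = adj G x} (outer (mem refl) (mem refl) p q)

    bipartition⇒≃Kbip : n / 2 ≡ a → G ≃G Kbip n
    bipartition⇒≃Kbip half with π , sorted ← sorting side = π , λ i j →
      trans (adj-xor (π ⟨$⟩ʳ i) (π ⟨$⟩ʳ j)) (trans (cong₂ (λ u w → if u then not w else w)
        (trans (sorted i) (cong (toℕ i <ᵇ_) (trans size-side (sym half))))
        (trans (sorted j) (cong (toℕ j <ᵇ_) (trans size-side (sym half))))) (Kbip-adj i j))
      where
      Kbip-adj : ∀ i j → (if toℕ i <ᵇ (n / 2) then not (toℕ j <ᵇ (n / 2)) else (toℕ j <ᵇ (n / 2))) ≡ adj (Kbip n) i j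
      Kbip-adj i j with toℕ i <ᵇ (n / 2)
      ... | true  = refl
      ... | false = refl

  ≃Kbip⇒bipartition : G ≃G Kbip n → Bipartition full (n / 2)
  ≃Kbip⇒bipartition (π , e) = record
    { side  = left ∘ (π ⟨$⟩ˡ_)
    ; size  = begin
        card (full ∩ (left ∘ (π ⟨$⟩ˡ_)))   ≡⟨ card-cong ∩ʳ (λ p → ∈∩ (mem refl) p) ⟩
        card (left ∘ (π ⟨$⟩ˡ_))            ≡⟨ card≡count _ ⟩
        count (left ∘ (π ⟨$⟩ˡ_))           ≡⟨ count-permute left (Perm.flip π) ⟩
        count left                         ≡⟨ count-<ᵇ n (n / 2) (m/n≤m n 2) ⟩
        n / 2                              ∎
    ; cross = λ { {x} {y} _ _ (mem p) q → mem (trans (adj≡ x y) (cong₂ xor′ p (∉⇒false {x = y} {left ∘ (π ⟨$⟩ˡ_)} q))) }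
    ; inner = λ { {x} {y} _ _ (mem p) (mem q) → false⇒∉ (trans (adj≡ x y) (cong₂ xor′ p q)) }
    ; outer = λ { {x} {y} _ _ p q → false⇒∉ (trans (adj≡ x y) (cong₂ xor′
        (∉⇒false {x = x} {left ∘ (π ⟨$⟩ˡ_)} p) (∉⇒false {x = y} {left ∘ (π ⟨$⟩ˡ_)} q))) }
    }
    where
    open ≡-Reasoning
    left : Fin n → Bool
    left i = toℕ i <ᵇ (n / 2)
    xor′ : Bool → Bool → Bool
    xor′ u w = if u then not w else w
    Kbip-adj : ∀ i j → adj (Kbip n) i j ≡ xor′ (left i) (left j)
    Kbip-adj i j with toℕ i <ᵇ (n / 2)
    ... | true  = refl
    ... | false = refl
    adj≡ : ∀ x y → adj G x y ≡ xor′ (left (π ⟨$⟩ˡ x)) (left (π ⟨$⟩ˡ y))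
    adj≡ x y = trans (cong₂ (adj G) (sym (Perm.inverseʳ π)) (sym (Perm.inverseʳ π))) (trans (e (π ⟨$⟩ˡ x) (π ⟨$⟩ˡ y)) (Kbip-adj _ _))

-- Floors, parity and the conclusion

data Halving : ℕ → Set where
  even : ∀ h → Halving (h + h)
  odd  : ∀ h → Halving (suc (h + h))

halving : ∀ n → Halving n
halving zero = even 0
halving (suc n) with halving n
... | even h = odd h
... | odd h  = subst Halving (cong suc (+-suc h h)) (even (suc h))

quarter-even : ∀ h → (h + h) * (h + h) / 4 ≡ h * h
quarter-even h = trans (cong (_/ 4) (arith h)) (m*n/n≡m (h * h) 4)
  where
  arith : ∀ h → (h + h) * (h + h) ≡ h * h * 4
  arith = solve-∀

quarter-odd : ∀ h → suc (h + h) * suc (h + h) / 4 ≡ h * suc h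
quarter-odd h = trans (cong (_/ 4) (arith h)) (trans (+-distrib-/-∣ʳ 1 {d = 4} (divides-refl (h * suc h))) (m*n/n≡m (h * suc h) 4))
  where
  arith : ∀ h → suc (h + h) * suc (h + h) ≡ 1 + h * suc h * 4
  arith = solve-∀

half-even : ∀ h → (h + h) / 2 ≡ h
half-even h = trans (cong (_/ 2) (trans (cong (h +_) (sym (+-identityʳ h))) (*-comm 2 h))) (m*n/n≡m h 2)

half-odd : ∀ h → suc (h + h) / 2 ≡ h
half-odd h = trans (cong (λ k → suc k / 2) (trans (cong (h +_) (sym (+-identityʳ h))) (*-comm 2 h)))
  (trans (+-distrib-/-∣ʳ 1 {d = 2} (divides-refl h)) (m*n/n≡m h 2))

-- 2h + 1 ≥ 8 already forces h ≥ 4, so this one hypothesis serves both parities.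
from-4 : ∀ h → 8 ≤ suc (h + h) → ∃ λ g → h ≡ 4 + g
from-4 (suc (suc (suc (suc g)))) _ = g , refl
from-4 0 (s≤s ())
from-4 1 (s≤s (s≤s (s≤s ())))
from-4 2 (s≤s (s≤s (s≤s (s≤s (s≤s ())))))
from-4 3 (s≤s (s≤s (s≤s (s≤s (s≤s (s≤s (s≤s ())))))))

theorem1p2 : (n : ℕ) → 8 ≤ n →
    ((G : Graph n) → D G ≤ 2 ^ (n * n / 4))
    × Σ (Graph n) (λ G → D G ≡ 2 ^ (n * n / 4))
    × ((G : Graph n) → (D G ≡ 2 ^ (n * n / 4)) ⇔ (G ≃G Kbip n))
theorem1p2 n 8≤n = conclude (split (halving n) 8≤n)
  where
  open Induction using (Bipartition)

  -- `b` is ⌈n/2⌉. The strict alternative yields uniqueness along with the upper bound.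
  Split : Set
  Split = Σ ℕ λ b → n ≡ n / 2 + b × n * n / 4 ≡ n / 2 * b ×
    (∀ G → Bipartition G full (n / 2) ⊎ D G < 2 ^ (n / 2 * b))

  split : Halving n → 8 ≤ n → Split
  split (even h) 8≤ with g , refl ← from-4 h (≤-trans 8≤ (n≤1+n _)) rewrite half-even (4 + g) =
    4 + g , refl , quarter-even (4 + g) , λ G → Sum.map₂
      (λ (k , D , lt) → ≤-<-trans (Count.DCov⇒D≤ G D) (<-ratio k (2 ^ ((4 + g) * (4 + g))) lt))
      (Induction.even-result G g full card-full)
  split (odd h) 8≤ with g , refl ← from-4 h 8≤ rewrite half-odd (4 + g) =
    5 + g , sym (+-suc (4 + g) (4 + g)) , quarter-odd (4 + g) , λ G → Sum.map₂
      (λ (k , D , lt) → ≤-<-trans (Count.DCov⇒D≤ G D) (<-≤-trans lt (≤-reflexive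
        (trans (sym (^-distribˡ-+-* 2 ((4 + g) * (4 + g)) (4 + g)))
          (cong (2 ^_) (trans (+-comm ((4 + g) * (4 + g)) _) (sym (*-suc (4 + g) (4 + g)))))))))
      (Induction.odd-result G g full card-full)

  conclude : Split → ((G : Graph n) → D G ≤ 2 ^ (n * n / 4))
    × Σ (Graph n) (λ G → D G ≡ 2 ^ (n * n / 4))
    × ((G : Graph n) → (D G ≡ 2 ^ (n * n / 4)) ⇔ (G ≃G Kbip n))
  conclude (b , n≡ , q≡ , dichotomy) rewrite q≡ =
    (λ G → [ (λ B → ≤-reflexive (Count.bipartition-D G n≡ B)) , <⇒≤ ]′ (dichotomy G)) ,
    (Kbip n , ≃⇒D (Kbip n) (Perm.id , λ _ _ → refl)) ,
    λ G → mk⇔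
      (λ e → [ (λ B → Count.bipartition⇒≃Kbip G n≡ B refl) , (λ lt → ⊥-elim (<⇒≢ lt e)) ]′ (dichotomy G))
      (≃⇒D G)
    where
    ≃⇒D : ∀ G → G ≃G Kbip n → D G ≡ 2 ^ (n / 2 * b)
    ≃⇒D G iso = Count.bipartition-D G n≡ (Count.≃Kbip⇒bipartition G iso)
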